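{- Let $n\ge 3$ and $1\le r\le n-2$ be integers, and let $K_n$ be the complete graph on $n$ vertices. If $n$ is even, or $n$ is odd and $r=\frac{n-1}{2}$, then \[ cms_r(K_n)=\left\lfloor \frac{rn-1}{2}\right\rfloor. \]
   Context: All graphs are simple. For an integer $N$, $[N]=\{0,1,\dots,N-1\}$. An ordering of a graph $G=(V,E)$ is a bijection $\ell:E\to[|E|]$; edges are cyclically consecutive in $\ell$ if their labels are consecutive integers modulo $|E|$. A graph is $(\le r)$-regular if every vertex has degree at most $r$. For an ordering $\ell$ of $G$, $cms_r(\ell)$ is the largest integer $s$ such that every $s$ cyclically consecutive edges of $\ell$ form a $(\le r)$-regular subgraph of $G$; $cms_r(G)$ is the maximum of $cms_r(\ell)$ over all orderings $\ell$ of $G$. -}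

module Defs where

open import Data.Nat using (ℕ; _+_; _*_; _∸_; _≤_; _<_; _≤ᵇ_; _<ᵇ_)
open import Data.Nat.Combinatorics using (_C_)
open import Data.Fin using (Fin; toℕ) renaming (_<_ to _<ᶠ_)
open import Data.Fin.Properties using () renaming (_≟_ to _≟ᶠ_)
open import Data.Bool using (Bool; _∧_; _∨_; if_then_else_)
open import Data.List using (map; allFin)
open import Data.Nat.ListAction using (sum)
open import Data.Product using (Σ; Σ-syntax; _×_; _,_)
open import Function.Bundles using (_↔_; Inverse)
open import Relation.Nullary.Decidable using (⌊_⌋)

-- Vertices of K_n are Fin n; edges of K_n are pairs i < j (each unordered pair once).
Edge : ℕ → Set
Edge n = Σ[ i ∈ Fin n ] Σ[ j ∈ Fin n ] (i <ᶠ j)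

numEdges : ℕ → ℕ
numEdges n = n C 2

Ordering : ℕ → Set
Ordering n = Edge n ↔ Fin (numEdges n)

incident : ∀ {n} → Fin n → Edge n → Bool
incident v (i , j , _) = ⌊ v ≟ᶠ i ⌋ ∨ ⌊ v ≟ᶠ j ⌋

-- label p lies in the cyclic window of length s starting at label k (labels mod m):
-- k ≤ p < k + s, or (wrapping around) p + m < k + s.
inWindow : (m k s p : ℕ) → Bool
inWindow m k s p = ((k ≤ᵇ p) ∧ (p <ᵇ k + s)) ∨ (p + m <ᵇ k + s)

windowDegree : ∀ {n} → Ordering n → (k s : ℕ) → Fin n → ℕ
windowDegree {n} ℓ k s v =
  sum (map (λ p → if inWindow (numEdges n) k s (toℕ p) ∧ incident v (Inverse.from ℓ p)
                  then 1 else 0)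
           (allFin (numEdges n)))

AllWindowsOK : ∀ {n} → ℕ → Ordering n → ℕ → Set
AllWindowsOK {n} r ℓ s =
  s ≤ numEdges n × ((k : Fin (numEdges n)) (v : Fin n) → windowDegree ℓ (toℕ k) s v ≤ r)

IsCms : ∀ {n} → ℕ → Ordering n → ℕ → Set
IsCms r ℓ s = AllWindowsOK r ℓ s × (∀ t → AllWindowsOK r ℓ t → t ≤ s)

IsCmsComplete : ℕ → ℕ → ℕ → Set
IsCmsComplete n r s =
  (Σ[ ℓ ∈ Ordering n ] IsCms r ℓ s) × (∀ (ℓ : Ordering n) t → IsCms r ℓ t → t ≤ s)

{-# OPTIONS --safe #-}

-- Upper bound: the degrees in a window of s edges sum to 2s ≤ rn. If 2s = rn, every window is
-- r-regular, so sliding a window by one replaces an edge by another one with the same ends.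
--
-- n = 2m: concatenate the n − 1 perfect matchings of a 1-factorization, as blocks of m edges.
-- A window of rm − 1 edges contains at most r edges at v provided that, for every t, the
-- position of v in block t exceeds its position in block t + r by at most one. For two blocks
-- this is achieved by walking along the even cycles of their union; for the factorization given
-- by sums in ℤ/g × ℤ/L, with g = gcd (r , n − 1) and gL = n − 1, it works for all t at once.
--
-- n = 2r + 1: in an Eulerian circuit every passage through v uses two cyclically consecutive
-- edges, and there are r passages. So it suffices to order the edges of a cycle of length
-- |E| such that ⌊(|E| − 1)/2⌋ cyclically consecutive ones always form a matching.
module Submission where

open import Defs
open import Data.Bool using (Bool; true; false; not; _∧_; if_then_else_; T)
open import Data.Bool.Properties using (T-≡; ∧-zeroʳ; ∨-zeroʳ; not-involutive)
open import Data.Empty using (⊥-elim)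
open import Data.Fin using (Fin; zero; suc; toℕ; fromℕ<; punchOut)
open import Data.Fin.Properties using (toℕ<n; toℕ-injective; toℕ-fromℕ<; any?; punchOut-injective; injective⇒≤; +↔⊎) renaming (_≟_ to _≟ᶠ_)
open import Data.List using (map; allFin; tabulate)
open import Data.List.Properties using (map-tabulate; map-cong)
open import Data.Nat hiding (Ordering)
open import Data.Nat.Combinatorics using (_C_; nC1≡n; nCk+nC[k+1]≡[n+1]C[k+1])
open import Data.Nat.Divisibility using (_∣_; divides; n∣m*n)
open import Data.Nat.DivMod
open import Data.Nat.GCD using (gcd; gcd[m,n]∣m; gcd[m,n]∣n; gcd-GCD; module Bézout)
open import Data.Nat.ListAction using (sum)
open import Data.Nat.Properties
open import Data.Nat.Tactic.RingSolver using (solve-∀)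
open import Data.Product using (Σ-syntax; ∃-syntax; _×_; _,_; proj₁; proj₂)
open import Data.Sum using (_⊎_; inj₁; inj₂)
open import Data.Sum.Function.Propositional using (_⊎-↔_)
open import Function using (_∘_; id; _↔_; Inverse; Equivalence; mk↔ₛ′; Injective)
open import Function.Properties.Inverse using (↔-refl; ↔-sym; ↔-trans)
open import Relation.Binary.Definitions using (tri<; tri≈; tri>)
open import Relation.Binary.PropositionalEquality
open import Relation.Nullary using (¬_; yes; no; contradiction)
open import Relation.Nullary.Decidable using (⌊_⌋)

-- Finite sums

-- For even `n` the obstacle is that the condition on positions closes up. On the N = n - 1 blocks,
-- repeated cyclically, t ↦ t + r has g orbits of length L, and all the way round each orbit the
-- position of every vertex may fall by at most one per step. So an orbit should run through colours
-- that differ by a fixed small step: the ℤ/g part of the colour names the orbit, and the ℤ/L part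
-- moves by -1. This dictates the timing of the blocks, through a number u with r′u ≡ -1 mod L,
-- where r = r′g. As N is odd, so are g and L; hence 2 is invertible and each colour class has
-- exactly one degenerate pair, which makes room for the vertex ∞. For odd `n` a vertex of K_n
-- corresponds to r vertices of the cycle of positions along the circuit. A matching of that cycle
-- meets each of them at most once, which bounds the degree by r. In both cases a labelling is only
-- shown to be injective; counting the edges makes it a bijection.

∑ : ℕ → (ℕ → ℕ) → ℕ
∑ zero    f = 0
∑ (suc n) f = f 0 + ∑ n (f ∘ suc)

∑-cong : ∀ n {f g} → (∀ i → i < n → f i ≡ g i) → ∑ n f ≡ ∑ n g
∑-cong zero    eq = refl
∑-cong (suc n) eq = cong₂ _+_ (eq 0 z<s) (∑-cong n λ i i<n → eq (suc i) (s<s i<n))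

∑-mono : ∀ n {f g} → (∀ i → i < n → f i ≤ g i) → ∑ n f ≤ ∑ n g
∑-mono zero    le = z≤n
∑-mono (suc n) le = +-mono-≤ (le 0 z<s) (∑-mono n λ i i<n → le (suc i) (s<s i<n))

∑-const : ∀ n c → ∑ n (λ _ → c) ≡ n * c
∑-const zero    c = refl
∑-const (suc n) c = cong (c +_) (∑-const n c)

∑-zero : ∀ n {f} → (∀ i → i < n → f i ≡ 0) → ∑ n f ≡ 0
∑-zero n eq = trans (∑-cong n eq) (trans (∑-const n 0) (*-zeroʳ n))

∑-split : ∀ m n f → ∑ (m + n) f ≡ ∑ m f + ∑ n (λ i → f (m + i))
∑-split zero    n f = refl
∑-split (suc m) n f =
  trans (cong (f 0 +_) (∑-split m n (f ∘ suc))) (sym (+-assoc (f 0) _ _))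

∑-last : ∀ n f → ∑ (suc n) f ≡ ∑ n f + f n
∑-last zero    f = +-identityʳ (f 0)
∑-last (suc n) f = trans (cong (f 0 +_) (∑-last n (f ∘ suc))) (sym (+-assoc (f 0) _ _))

+-interchange : ∀ a b c d → a + b + (c + d) ≡ a + c + (b + d)
+-interchange = solve-∀

∑-+ : ∀ n f g → ∑ n (λ i → f i + g i) ≡ ∑ n f + ∑ n g
∑-+ zero    f g = refl
∑-+ (suc n) f g =
  trans (cong (f 0 + g 0 +_) (∑-+ n (f ∘ suc) (g ∘ suc))) (+-interchange (f 0) (g 0) _ _)

∑-swap : ∀ m n (f : ℕ → ℕ → ℕ) → ∑ m (λ i → ∑ n (f i)) ≡ ∑ n (λ j → ∑ m (λ i → f i j))
∑-swap zero    n f = sym (∑-zero n λ _ _ → refl)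
∑-swap (suc m) n f =
  trans (cong (∑ n (f 0) +_) (∑-swap m n (f ∘ suc))) (sym (∑-+ n (f 0) _))

∑-≤-length : ∀ {m n} f → m ≤ n → ∑ m f ≤ ∑ n f
∑-≤-length {m} f m≤n with k , refl ← m≤n⇒∃[o]m+o≡n m≤n =
  subst (∑ m f ≤_) (sym (∑-split m k f)) (m≤m+n _ _)

-- A term below `r` could not be made up by the others. This turns a degree sum of `rn` into
-- regularity.
∑-tight : ∀ n {f r} → (∀ i → i < n → f i ≤ r) → n * r ≤ ∑ n f → ∀ i → i < n → f i ≡ r
∑-tight (suc n) {f} {r} le tight zero    _ =
  ≤-antisym (le 0 z<s) (+-cancelʳ-≤ (n * r) r (f 0) (≤-trans tight (+-monoʳ-≤ (f 0) bound)))
  where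
  bound : ∑ n (f ∘ suc) ≤ n * r
  bound = subst (∑ n (f ∘ suc) ≤_) (∑-const n r) (∑-mono n λ i i<n → le (suc i) (s<s i<n))
∑-tight (suc n) {f} {r} le tight (suc i) (s<s i<n) =
  ∑-tight n (λ j j<n → le (suc j) (s<s j<n))
    (+-cancelˡ-≤ r (n * r) _ (≤-trans tight (+-monoˡ-≤ _ (le 0 z<s)))) i i<n

sum-allFin : ∀ n (f : ℕ → ℕ) → sum (map (f ∘ toℕ) (allFin n)) ≡ ∑ n f
sum-allFin n f = 
  trans (cong (λ xs → sum xs) (map-tabulate {n = n} id (λ i → f (toℕ i)))) (sum-tabulate n f)
  where
  sum-tabulate : ∀ n (f : ℕ → ℕ) → sum (tabulate {n = n} (f ∘ toℕ)) ≡ ∑ n f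
  sum-tabulate zero    f = refl
  sum-tabulate (suc n) f = cong (f 0 +_) (sum-tabulate n (f ∘ suc))

Periodic : ℕ → (ℕ → ℕ) → Set
Periodic m f = ∀ x → f (x + m) ≡ f x

∑-period : ∀ {m f} → Periodic m f → ∀ k → ∑ m (λ i → f (k + i)) ≡ ∑ m f
∑-period per zero = refl
∑-period {m} {f} per (suc k) = trans shift (∑-period per k)
  where
  shift : ∑ m (λ i → f (suc k + i)) ≡ ∑ m (λ i → f (k + i))
  shift = +-cancelˡ-≡ (f (k + 0)) _ _ (begin
    f (k + 0) + ∑ m (λ i → f (suc k + i))
      ≡⟨ cong (f (k + 0) +_) (∑-cong m λ i _ → cong f (sym (+-suc k i))) ⟩
    ∑ (suc m) (λ i → f (k + i))            ≡⟨ ∑-last m (λ i → f (k + i)) ⟩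
    ∑ m (λ i → f (k + i)) + f (k + m)      ≡⟨ +-comm _ (f (k + m)) ⟩
    f (k + m) + ∑ m (λ i → f (k + i))      ≡⟨ cong (_+ ∑ m (λ i → f (k + i))) (trans (per k) (cong f (sym (+-identityʳ k)))) ⟩
    f (k + 0) + ∑ m (λ i → f (k + i))      ∎)
    where open ≡-Reasoning

-- Indicators

true! : ∀ {b} → T b → b ≡ true
true! = Equivalence.to T-≡

false! : ∀ {b} → ¬ T b → b ≡ false
false! {true}  ¬t = ⊥-elim (¬t _)
false! {false} _  = refl

≤ᵇ-true : ∀ {m n} → m ≤ n → (m ≤ᵇ n) ≡ true
≤ᵇ-true m≤n = true! (≤⇒≤ᵇ m≤n)

≤ᵇ-false : ∀ {m n} → n < m → (m ≤ᵇ n) ≡ false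
≤ᵇ-false {m} n<m = false! λ t → <⇒≱ n<m (≤ᵇ⇒≤ m _ t)

<ᵇ-true : ∀ {m n} → m < n → (m <ᵇ n) ≡ true
<ᵇ-true m<n = true! (<⇒<ᵇ m<n)

<ᵇ-false : ∀ {m n} → n ≤ m → (m <ᵇ n) ≡ false
<ᵇ-false {m} n≤m = false! λ t → ≤⇒≯ n≤m (<ᵇ⇒< m _ t)

δ : ℕ → ℕ → ℕ
δ m n = if m ≡ᵇ n then 1 else 0

≡ᵇ-refl : ∀ n → (n ≡ᵇ n) ≡ true
≡ᵇ-refl n = true! (≡⇒≡ᵇ n n refl)

≡ᵇ-false : ∀ {m n} → m ≢ n → (m ≡ᵇ n) ≡ false
≡ᵇ-false {m} {n} m≢n = false! λ t → m≢n (≡ᵇ⇒≡ m n t)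

δ-refl : ∀ n → δ n n ≡ 1
δ-refl n rewrite ≡ᵇ-refl n = refl

δ-≢ : ∀ {m n} → m ≢ n → δ m n ≡ 0
δ-≢ m≢n rewrite ≡ᵇ-false m≢n = refl

δ-≡ : ∀ {m n} → δ m n ≢ 0 → m ≡ n
δ-≡ {m} {n} ne with m ≟ n
... | yes m≡n = m≡n
... | no  m≢n = contradiction (δ-≢ m≢n) ne

∑-δ : ∀ n {i} → i < n → ∑ n (λ v → δ v i) ≡ 1
∑-δ (suc n) {zero}  _         = cong suc (∑-zero n λ _ _ → refl)
∑-δ (suc n) {suc i} (s<s i<n) = ∑-δ n i<n

-- Orderings from injective labellings

2*nC2 : ∀ n → 2 * (suc n C 2) ≡ suc n * n
2*nC2 zero    = refl
2*nC2 (suc n) = begin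
  2 * (suc (suc n) C 2)             ≡⟨ cong (2 *_) (sym (nCk+nC[k+1]≡[n+1]C[k+1] (suc n) 1)) ⟩
  2 * (suc n C 1 + suc n C 2)       ≡⟨ *-distribˡ-+ 2 (suc n C 1) (suc n C 2) ⟩
  2 * (suc n C 1) + 2 * (suc n C 2) ≡⟨ cong₂ (λ a b → 2 * a + b) (nC1≡n (suc n)) (2*nC2 n) ⟩
  2 * suc n + suc n * n             ≡⟨ lemma n ⟩
  suc (suc n) * suc n               ∎
  where
  open ≡-Reasoning
  lemma : ∀ n → 2 * suc n + suc n * n ≡ suc (suc n) * suc n
  lemma = solve-∀

numEdges-unique : ∀ n {e} → 2 * e ≡ suc n * n → numEdges (suc n) ≡ e
numEdges-unique n eq = *-cancelˡ-≡ _ _ 2 (trans (2*nC2 n) (sym eq))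

edge-≡ : ∀ {n} {e e′ : Edge n} → proj₁ e ≡ proj₁ e′ → proj₁ (proj₂ e) ≡ proj₁ (proj₂ e′) → e ≡ e′
edge-≡ {e = i , j , p} {e′ = .i , .j , q} refl refl = cong (λ p → i , j , p) (<-irrelevant p q)

edge-split : ∀ n → Edge (suc n) ↔ (Fin n ⊎ Edge n)
edge-split n = mk↔ₛ′ to from to∘from from∘to
  where
  to : Edge (suc n) → Fin n ⊎ Edge n
  to (zero  , suc j , _)     = inj₁ j
  to (suc i , suc j , s<s p) = inj₂ (i , j , p)
  from : Fin n ⊎ Edge n → Edge (suc n)
  from (inj₁ j)           = zero , suc j , z<s
  from (inj₂ (i , j , p)) = suc i , suc j , s<s p
  to∘from : ∀ x → to (from x) ≡ x
  to∘from (inj₁ j)           = refl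
  to∘from (inj₂ (i , j , p)) = refl
  from∘to : ∀ e → from (to e) ≡ e
  from∘to (zero  , suc j , z<s)   = refl
  from∘to (suc i , suc j , s<s p) = refl

someOrdering : ∀ n → Ordering n
someOrdering zero    = mk↔ₛ′ (λ { (() , _) }) (λ ()) (λ ()) (λ { (() , _) })
someOrdering (suc n) =
  subst (λ k → Edge (suc n) ↔ Fin k) (trans (cong (_+ n C 2) (sym (nC1≡n n))) (nCk+nC[k+1]≡[n+1]C[k+1] n 1))
    (↔-trans (edge-split n) (↔-trans (↔-refl ⊎-↔ someOrdering n) (↔-sym +↔⊎)))

-- Pigeonhole: removing a missed value `y` would squeeze the map injectively into a smaller `Fin`.
injective⇒surjective : ∀ {n} (f : Fin n → Fin n) → Injective _≡_ _≡_ f → ∀ y → ∃[ x ] f x ≡ y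
injective⇒surjective {suc n} f inj y with any? (λ x → f x ≟ᶠ y)
... | yes hit = hit
... | no miss = contradiction (injective⇒≤ punched-injective) 1+n≰n
  where
  y≢f : ∀ x → y ≢ f x
  y≢f x eq = miss (x , sym eq)
  punched-injective : Injective _≡_ _≡_ (λ x → punchOut (y≢f x))
  punched-injective eq = inj (punchOut-injective (y≢f _) (y≢f _) eq)

-- Composed with the enumeration of edges in `someOrdering`, `label` becomes an injective self-map
-- of `Fin`, which has an inverse.
injective⇒ordering : ∀ {n} (label : Edge n → Fin (numEdges n)) → Injective _≡_ _≡_ label →
  Σ[ ℓ ∈ Ordering n ] (∀ e → Inverse.to ℓ e ≡ label e)
injective⇒ordering {n} label inj = mk↔ₛ′ label from to∘from from∘to , λ _ → refl
  where
  open Inverse (someOrdering n) using () renaming (from to base; to to base⁻¹; strictlyInverseʳ to base∘base⁻¹; strictlyInverseˡ to base⁻¹∘base)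
  onto : ∀ p → ∃[ x ] label (base x) ≡ p
  onto = injective⇒surjective (label ∘ base)
    λ {x} {y} eq → trans (sym (base⁻¹∘base x)) (trans (cong base⁻¹ (inj eq)) (base⁻¹∘base y))
  from : Fin (numEdges n) → Edge n
  from p = base (proj₁ (onto p))
  to∘from : ∀ p → label (from p) ≡ p
  to∘from p = proj₂ (onto p)
  from∘to : ∀ e → from (label e) ≡ e
  from∘to e = inj (to∘from (label e))

-- Window degrees as sums

-- A sum in place of the disjunction, so that degrees can be added up over vertices and edges. The
-- values agree because the two ends of an edge differ.
inc : ∀ {n} → ℕ → Edge n → ℕ
inc v (i , j , _) = δ v (toℕ i) + δ v (toℕ j)

≟ᶠ-≡ᵇ : ∀ {n} (v i : Fin n) → ⌊ v ≟ᶠ i ⌋ ≡ (toℕ v ≡ᵇ toℕ i)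
≟ᶠ-≡ᵇ v i with v ≟ᶠ i
... | yes refl = sym (≡ᵇ-refl (toℕ v))
... | no v≢i   = sym (≡ᵇ-false (v≢i ∘ toℕ-injective))

incident-inc : ∀ {n} (v : Fin n) (e : Edge n) → (if incident v e then 1 else 0) ≡ inc (toℕ v) e
incident-inc v (i , j , i<j) rewrite ≟ᶠ-≡ᵇ v i | ≟ᶠ-≡ᵇ v j with toℕ v ≟ toℕ i
... | yes v≡i rewrite v≡i | ≡ᵇ-refl (toℕ i) | ≡ᵇ-false (<⇒≢ i<j) = refl
... | no v≢i  rewrite ≡ᵇ-false v≢i = refl

inWindow-true : ∀ m k {s p} → k ≤ p → p < k + s → inWindow m k s p ≡ true
inWindow-true m k k≤p p<k+s rewrite ≤ᵇ-true k≤p | <ᵇ-true p<k+s = refl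

inWindow-wrap : ∀ m k {s p} → p + m < k + s → inWindow m k s p ≡ true
inWindow-wrap m k lt rewrite <ᵇ-true lt = ∨-zeroʳ _

inWindow-left : ∀ m k {s p} → p < k → k + s ≤ p + m → inWindow m k s p ≡ false
inWindow-left m k p<k ge rewrite ≤ᵇ-false p<k | <ᵇ-false ge = refl

inWindow-right : ∀ m k {s p} → k + s ≤ p → inWindow m k s p ≡ false
inWindow-right m k {s} {p} ge rewrite <ᵇ-false ge | <ᵇ-false (≤-trans ge (m≤m+n p m)) | ∧-zeroʳ (k ≤ᵇ p) = refl

-- Trades the Boolean window test for a sum over consecutive indices; wrapping around becomes
-- periodicity of `f`.
∑-window : ∀ m (f : ℕ → ℕ) → Periodic m f → ∀ k s → k < m → s ≤ m →
  ∑ m (λ p → if inWindow m k s p then f p else 0) ≡ ∑ s (λ i → f (k + i))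
∑-window m f per k s k<m s≤m with ≤-total (k + s) m
... | inj₁ k+s≤m with d , refl ← m≤n⇒∃[o]m+o≡n k+s≤m = begin
  ∑ (k + s + d) w                                                ≡⟨ ∑-split (k + s) d w ⟩
  ∑ (k + s) w + ∑ d (λ i → w (k + s + i))                        ≡⟨ cong₂ _+_ (∑-split k s w) (∑-zero d right) ⟩
  ∑ k w + ∑ s (λ i → w (k + i)) + 0                              ≡⟨ +-identityʳ _ ⟩
  ∑ k w + ∑ s (λ i → w (k + i))                                  ≡⟨ cong₂ _+_ (∑-zero k left) (∑-cong s middle) ⟩
  ∑ s (λ i → f (k + i))                                          ∎
  where
  open ≡-Reasoning
  w : ℕ → ℕ
  w p = if inWindow (k + s + d) k s p then f p else 0
  left : ∀ i → i < k → w i ≡ 0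
  left i i<k rewrite inWindow-left (k + s + d) k {s} i<k (≤-trans (m≤m+n (k + s) d) (m≤n+m _ i)) = refl
  middle : ∀ i → i < s → w (k + i) ≡ f (k + i)
  middle i i<s rewrite inWindow-true (k + s + d) k {s} (m≤m+n k i) (+-monoʳ-< k i<s) = refl
  right : ∀ i → i < d → w (k + s + i) ≡ 0
  right i _ rewrite inWindow-right (k + s + d) k {s} (m≤m+n (k + s) i) = refl
-- The window wraps: it consists of the last `b` and the first `o` labels and misses the `c` labels
-- between them.
... | inj₂ m≤k+s with b , refl ← m≤n⇒∃[o]m+o≡n (<⇒≤ k<m)
    with o , refl ← m≤n⇒∃[o]m+o≡n (+-cancelˡ-≤ k b s m≤k+s)
    with c , refl ← m≤n⇒∃[o]m+o≡n (+-cancelˡ-≤ b o k (subst (b + o ≤_) (+-comm k b) s≤m)) = begin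
  ∑ (o + c + b) w                                        ≡⟨ ∑-split (o + c) b w ⟩
  ∑ (o + c) w + ∑ b (λ i → w (o + c + i))                ≡⟨ cong₂ _+_ (∑-split o c w) (∑-cong b right) ⟩
  ∑ o w + ∑ c (λ i → w (o + i)) + R                      ≡⟨ cong (_+ R) (cong₂ _+_ (∑-cong o left) (∑-zero c middle)) ⟩
  ∑ o f + 0 + R                                          ≡⟨ cong (_+ R) (+-identityʳ _) ⟩
  ∑ o f + R                                              ≡⟨ +-comm (∑ o f) R ⟩
  R + ∑ o f                                              ≡⟨ cong (R +_) (∑-cong o wrapped) ⟨
  R + ∑ o (λ i → f (o + c + (b + i)))                    ≡⟨ ∑-split b o (λ i → f (o + c + i)) ⟨
  ∑ (b + o) (λ i → f (o + c + i))                        ∎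
  where
  open ≡-Reasoning
  M = o + c + b
  R = ∑ b (λ i → f (o + c + i))
  w : ℕ → ℕ
  w p = if inWindow M (o + c) (b + o) p then f p else 0
  total : o + c + (b + o) ≡ o + M
  total = lemma o c b
    where
    lemma : ∀ o c b → o + c + (b + o) ≡ o + (o + c + b)
    lemma = solve-∀
  left : ∀ i → i < o → w i ≡ f i
  left i i<o rewrite inWindow-wrap M (o + c) {b + o} {i} (subst (i + M <_) (sym total) (+-monoˡ-< M i<o)) = refl
  middle : ∀ i → i < c → w (o + i) ≡ 0
  middle i i<c rewrite inWindow-left M (o + c) {b + o} (+-monoʳ-< o i<c)
    (subst (_≤ o + i + M) (sym total) (+-monoˡ-≤ M (m≤m+n o i))) = refl
  right : ∀ i → i < b → w (o + c + i) ≡ f (o + c + i)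
  right i i<b rewrite inWindow-true M (o + c) {b + o} (m≤m+n (o + c) i) (+-monoʳ-< (o + c) (≤-trans i<b (m≤m+n b o))) = refl
  wrapped : ∀ i → i < o → f (o + c + (b + i)) ≡ f i
  wrapped i _ = trans (cong f (trans (sym (+-assoc (o + c) b i)) (+-comm M i))) (per i)

edgeAt : ∀ {n} → Ordering n → .{{NonZero (numEdges n)}} → ℕ → Edge n
edgeAt {n} ℓ x = Inverse.from ℓ (x mod numEdges n)

edgeAt-periodic : ∀ {n} (ℓ : Ordering n) .{{_ : NonZero (numEdges n)}} v →
  Periodic (numEdges n) (λ x → inc v (edgeAt ℓ x))
edgeAt-periodic {n} ℓ v x = cong (inc v ∘ Inverse.from ℓ)
  (toℕ-injective (trans (toℕ-fromℕ< _) (trans ([m+n]%n≡m%n x (numEdges n)) (sym (toℕ-fromℕ< _)))))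

label-edgeAt : ∀ {n} (ℓ : Ordering n) .{{_ : NonZero (numEdges n)}} x →
  toℕ (Inverse.to ℓ (edgeAt ℓ x)) ≡ x % numEdges n
label-edgeAt ℓ x = trans (cong toℕ (Inverse.strictlyInverseˡ ℓ _)) (toℕ-fromℕ< _)

windowDegree-∑ : ∀ {n} (ℓ : Ordering n) .{{_ : NonZero (numEdges n)}} {k s} (v : Fin n) →
  k < numEdges n → s ≤ numEdges n →
  windowDegree ℓ k s v ≡ ∑ s (λ i → inc (toℕ v) (edgeAt ℓ (k + i)))
windowDegree-∑ {n} ℓ {k} {s} v k<E s≤E = begin
  windowDegree ℓ k s v           ≡⟨ cong sum (map-cong pointwise (allFin E)) ⟩
  sum (map (w ∘ toℕ) (allFin E)) ≡⟨ sum-allFin E w ⟩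
  ∑ E w                          ≡⟨ ∑-window E h (edgeAt-periodic ℓ (toℕ v)) k s k<E s≤E ⟩
  ∑ s (λ i → h (k + i))          ∎
  where
  open ≡-Reasoning
  E = numEdges n
  h w : ℕ → ℕ
  h x = inc (toℕ v) (edgeAt ℓ x)
  w p = if inWindow E k s p then h p else 0
  toℕ-mod : ∀ (p : Fin E) → toℕ p mod E ≡ p
  toℕ-mod p = toℕ-injective (trans (toℕ-fromℕ< _) (m<n⇒m%n≡m (toℕ<n p)))
  pointwise : ∀ p → (if inWindow E k s (toℕ p) ∧ incident v (Inverse.from ℓ p) then 1 else 0) ≡ w (toℕ p)
  pointwise p with inWindow E k s (toℕ p)
  ... | false = refl
  ... | true  = trans (incident-inc v (Inverse.from ℓ p)) (cong (inc (toℕ v) ∘ Inverse.from ℓ) (sym (toℕ-mod p)))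

-- The upper bound

handshake : ∀ {n} (e : Edge n) → ∑ n (λ v → inc v e) ≡ 2
handshake {n} (i , j , _) =
  trans (∑-+ n (λ v → δ v (toℕ i)) (λ v → δ v (toℕ j))) (cong₂ _+_ (∑-δ n (toℕ<n i)) (∑-δ n (toℕ<n j)))

inc-first : ∀ {n} (e : Edge n) → inc (toℕ (proj₁ e)) e ≢ 0
inc-first (i , j , _) eq with () ← trans (sym (δ-refl (toℕ i))) (m+n≡0⇒m≡0 _ eq)

inc-second : ∀ {n} (e : Edge n) → inc (toℕ (proj₁ (proj₂ e))) e ≢ 0
inc-second (i , j , _) eq with () ← trans (sym (δ-refl (toℕ j))) (m+n≡0⇒n≡0 (δ (toℕ j) (toℕ i)) eq)

inc⇒endpoint : ∀ {n} v (e : Edge n) → inc v e ≢ 0 → v ≡ toℕ (proj₁ e) ⊎ v ≡ toℕ (proj₁ (proj₂ e))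
inc⇒endpoint v (i , j , _) ne with v ≟ toℕ i
... | yes v≡i = inj₁ v≡i
... | no v≢i  = inj₂ (δ-≡ λ eq → ne (cong₂ _+_ (δ-≢ v≢i) eq))

inc-determines : ∀ {n} (e e′ : Edge n) → (∀ v → v < n → inc v e ≡ inc v e′) → e ≡ e′
inc-determines e@(i , j , i<j) e′@(i′ , j′ , i′<j′) eq
  with inc⇒endpoint (toℕ i) e′ (λ z → inc-first e (trans (eq _ (toℕ<n i)) z))
     | inc⇒endpoint (toℕ j) e′ (λ z → inc-second e (trans (eq _ (toℕ<n j)) z))
... | inj₁ i≡i′ | inj₂ j≡j′ = edge-≡ (toℕ-injective i≡i′) (toℕ-injective j≡j′)
... | inj₁ i≡i′ | inj₁ j≡i′ = contradiction (trans i≡i′ (sym j≡i′)) (<⇒≢ i<j)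
... | inj₂ i≡j′ | inj₂ j≡j′ = contradiction (trans i≡j′ (sym j≡j′)) (<⇒≢ i<j)
... | inj₂ i≡j′ | inj₁ j≡i′ = contradiction (subst₂ _<_ i≡j′ j≡i′ i<j) (<-asym i′<j′)

cms-upper : ∀ n r → 3 ≤ n → 1 ≤ r → r ≤ n ∸ 2 → (ℓ : Ordering n) → ∀ t → AllWindowsOK r ℓ t →
  t ≤ (r * n ∸ 1) / 2
cms-upper n@(suc (suc (suc n-3))) r 3≤n@(s≤s (s≤s (s≤s z≤n))) 1≤r r≤n-2 ℓ t (t≤E , ok) =
  subst (_≤ (r * n ∸ 1) / 2) (m*n/n≡m t 2) (/-monoˡ-≤ 2 (subst (_≤ r * n ∸ 1) (*-comm 2 t) 2t≤rn-1))
  where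
  E = numEdges n
  2E : 2 * E ≡ n * (2 + n-3)
  2E = 2*nC2 (2 + n-3)
  1<E : 1 < E
  1<E = *-cancelˡ-< 2 1 E (subst (2 <_) (sym 2E) (≤-trans 3≤n (m≤m*n n (2 + n-3))))
  instance
    E≢0 : NonZero E
    E≢0 = >-nonZero (<-trans z<s 1<E)
  h : ℕ → ℕ → ℕ
  h v x = inc v (edgeAt ℓ x)
  bounded : ∀ k → k < E → ∀ v → v < n → ∑ t (λ i → h v (k + i)) ≤ r
  bounded k k<E v v<n = subst₂ (λ a b → ∑ t (λ i → h a (b + i)) ≤ r) (toℕ-fromℕ< v<n) (toℕ-fromℕ< k<E)
    (subst (_≤ r) (windowDegree-∑ ℓ (fromℕ< v<n) (toℕ<n (fromℕ< k<E)) t≤E) (ok (fromℕ< k<E) (fromℕ< v<n)))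
  total : ∀ k → ∑ n (λ v → ∑ t (λ i → h v (k + i))) ≡ t * 2
  total k = trans (∑-swap n t (λ v i → h v (k + i))) (trans (∑-cong t λ i _ → handshake (edgeAt ℓ (k + i))) (∑-const t 2))
  2t≤rn-1 : 2 * t ≤ r * n ∸ 1
  2t≤rn-1 with 2 * t <? r * n
  ... | yes lt = <⇒≤pred lt
  ... | no ge = contradiction same-edge different
    where
    -- Here `rn ≤ 2t`, while the `n` degrees in a window sum to `2t` and none exceeds `r`.
    regular : ∀ k → k < E → ∀ v → v < n → ∑ t (λ i → h v (k + i)) ≡ r
    regular k k<E = ∑-tight n (bounded k k<E)
      (subst₂ _≤_ (*-comm r n) (trans (*-comm 2 t) (sym (total k))) (≮⇒≥ ge))
    2t≤rn : 2 * t ≤ n * r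
    2t≤rn = subst₂ _≤_ (trans (total 0) (*-comm t 2)) (∑-const n r) (∑-mono n (bounded 0 (<-trans z<s 1<E)))
    -- From `r ≤ n − 2` follows `2t ≤ nr < n(n − 1) = 2E`. Together with `0 < t` this makes the
    -- labels `0` and `t` belong to different edges.
    t<E : t < E
    t<E = *-cancelˡ-< 2 t E (≤-<-trans 2t≤rn (subst (n * r <_) (sym 2E) (*-monoʳ-< n (s≤s r≤n-2))))
    0<t : 0 < t
    0<t = *-cancelˡ-< 2 0 t (≤-trans (*-mono-≤ 1≤r (≤-trans z<s 3≤n)) (≮⇒≥ ge))
    exchange : ∀ v → v < n → h v 0 ≡ h v t
    exchange v v<n = +-cancelʳ-≡ r _ _ (begin
      h v 0 + r                       ≡⟨ cong (h v 0 +_) (regular 1 1<E v v<n) ⟨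
      ∑ (suc t) (h v)                 ≡⟨ ∑-last t (h v) ⟩
      ∑ t (h v) + h v t               ≡⟨ cong (_+ h v t) (regular 0 (<-trans z<s 1<E) v v<n) ⟩
      r + h v t                       ≡⟨ +-comm r (h v t) ⟩
      h v t + r                       ∎)
      where open ≡-Reasoning
    same-edge : edgeAt ℓ 0 ≡ edgeAt ℓ t
    same-edge = inc-determines _ _ exchange
    different : edgeAt ℓ 0 ≢ edgeAt ℓ t
    different eq = <⇒≢ 0<t (begin
      0                                   ≡⟨ m<n⇒m%n≡m (<-trans z<s 1<E) ⟨
      0 % E                               ≡⟨ label-edgeAt ℓ 0 ⟨
      toℕ (Inverse.to ℓ (edgeAt ℓ 0))     ≡⟨ cong (toℕ ∘ Inverse.to ℓ) eq ⟩
      toℕ (Inverse.to ℓ (edgeAt ℓ t))     ≡⟨ label-edgeAt ℓ t ⟩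
      t % E                               ≡⟨ m<n⇒m%n≡m t<E ⟩
      t                                   ∎)
      where open ≡-Reasoning

-- Interface for both constructions. The window condition is stated for any `edge` that inverts
-- `label` modulo `E`, so they need not mention the inverse bijection.
cms-from-labelling : ∀ n r s E .{{_ : NonZero E}} → numEdges n ≡ E →
  3 ≤ n → 1 ≤ r → r ≤ n ∸ 2 → (r * n ∸ 1) / 2 ≡ s → s ≤ E →
  (label : Edge n → ℕ) → (∀ e → label e < E) → (∀ {e e′} → label e ≡ label e′ → e ≡ e′) →
  (∀ v (edge : ℕ → Edge n) → (∀ x → label (edge x) ≡ x % E) →
    ∀ k → k < E → ∑ s (λ i → inc v (edge (k + i))) ≤ r) →
  IsCmsComplete n r ((r * n ∸ 1) / 2)
cms-from-labelling n r s E refl 3≤n 1≤r r≤n-2 refl s≤E label bound inj ok =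
  (ℓ , (s≤E , windows) , cms-upper n r 3≤n 1≤r r≤n-2 ℓ) , λ ℓ t (t-ok , _) → cms-upper n r 3≤n 1≤r r≤n-2 ℓ t t-ok
  where
  ordering = injective⇒ordering (λ e → fromℕ< (bound e))
    (λ eq → inj (trans (sym (toℕ-fromℕ< _)) (trans (cong toℕ eq) (toℕ-fromℕ< _))))
  ℓ = proj₁ ordering
  to≡label : ∀ e → toℕ (Inverse.to ℓ e) ≡ label e
  to≡label e = trans (cong toℕ (proj₂ ordering e)) (toℕ-fromℕ< (bound e))
  windows : ∀ k v → windowDegree ℓ (toℕ k) s v ≤ r
  windows k v = subst (_≤ r) (sym (windowDegree-∑ ℓ v (toℕ<n k) s≤E))
    (ok (toℕ v) (edgeAt ℓ) (λ x → trans (sym (to≡label _)) (label-edgeAt ℓ x)) (toℕ k) (toℕ<n k))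

-- Parity

even : ℕ → Bool
even zero    = true
even (suc n) = not (even n)

even-double : ∀ n → even (n + n) ≡ true
even-double zero = refl
even-double (suc n) rewrite +-suc n n | even-double n = refl

even-split : ∀ n → (∃[ h ] n ≡ h + h) ⊎ (∃[ h ] n ≡ suc (h + h))
even-split zero = inj₁ (0 , refl)
even-split (suc n) with even-split n
... | inj₁ (h , refl) = inj₂ (h , refl)
... | inj₂ (h , refl) = inj₁ (suc h , cong suc (sym (+-suc h h)))

∑-double : ∀ n f → ∑ (n + n) f ≡ ∑ n (λ j → f (j + j) + f (suc (j + j)))
∑-double zero f = refl
∑-double (suc n) f rewrite +-suc n n =
  trans (sym (+-assoc (f 0) (f 1) _)) (cong (f 0 + f 1 +_) (trans (∑-double n (λ i → f (2+ i)))
    (∑-cong n λ j _ → cong (λ i → f (suc i) + f (suc (suc i))) (sym (+-suc j j)))))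

-- An Eulerian circuit of K₂q₊₁

-- The closed walk 0, n+1, 1, n, 2, n+1, 3, n, …, n−1, n+1, n (for odd n), which
-- traverses every edge of K_{n+2} not in K_n once and returns to 0.
petal : ℕ → ℕ → ℕ
petal n y = if y <ᵇ suc (n + n)
  then (if even y then ⌊ y /2⌋ else (if even ⌊ y /2⌋ then suc n else n))
  else 0

circuit : ℕ → ℕ → ℕ
circuit zero    x = 0
circuit (suc q) x = if x <ᵇ q * suc (q + q) then circuit q x else petal (suc (q + q)) (x ∸ q * suc (q + q))

petal-even : ∀ n j → j ≤ n → petal n (j + j) ≡ j
petal-even n j j≤n rewrite <ᵇ-true (s≤s (+-mono-≤ j≤n j≤n)) | even-double j = sym (n≡⌊n+n/2⌋ j)

petal-odd : ∀ n j → j < n → petal n (suc (j + j)) ≡ (if even j then suc n else n)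
petal-odd n j j<n rewrite <ᵇ-true (s<s (+-mono-< j<n j<n)) | even-double j | sym (n≡⌈n+n/2⌉ j) = refl

petal-end : ∀ n → petal n (suc (n + n)) ≡ 0
petal-end n rewrite <ᵇ-false (≤-refl {suc (n + n)}) = refl

petal-< : ∀ n y → petal n y < suc (suc n)
petal-< n y with y <? suc (n + n)
... | no y≮ rewrite <ᵇ-false (≮⇒≥ y≮) = z<s
... | yes y< rewrite <ᵇ-true y< with even y | even ⌊ y /2⌋
...   | true  | _     = s<s (≤-trans (⌊n/2⌋-mono (s≤s⁻¹ y<)) (≤-trans (≤-reflexive (sym (n≡⌊n+n/2⌋ n))) (n≤1+n n)))
...   | false | true  = ≤-refl
...   | false | false = n≤1+n (suc n)

circuit-low : ∀ q x → x < q * suc (q + q) → circuit (suc q) x ≡ circuit q x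
circuit-low q x x< rewrite <ᵇ-true x< = refl

circuit-high : ∀ q y → circuit (suc q) (q * suc (q + q) + y) ≡ petal (suc (q + q)) y
circuit-high q y rewrite <ᵇ-false (m≤m+n (q * suc (q + q)) y) | m+n∸m≡n (q * suc (q + q)) y = refl

-- Passing from `K_n` to `K_{n+2}`, with `n = 2q + 1`, adds `2n + 1` edges, one for each step of the
-- petal.
circuit-length : ∀ q → suc q * suc (suc q + suc q) ≡ q * suc (q + q) + suc (suc (q + q) + suc (q + q))
circuit-length = solve-∀

circuit-closed : ∀ q → circuit q (q * suc (q + q)) ≡ 0
circuit-closed zero    = refl
circuit-closed (suc q) = trans (cong (circuit (suc q)) (circuit-length q))
  (trans (circuit-high q (suc (suc (q + q) + suc (q + q)))) (petal-end (suc (q + q))))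

circuit-0 : ∀ q → circuit q 0 ≡ 0
circuit-0 zero          = refl
circuit-0 (suc zero)    = refl
circuit-0 (suc (suc q)) = circuit-0 (suc q)

circuit-low′ : ∀ q x → x ≤ q * suc (q + q) → circuit (suc q) x ≡ circuit q x
circuit-low′ q x x≤ with m≤n⇒m<n∨m≡n x≤
... | inj₁ x<   = circuit-low q x x<
... | inj₂ refl = trans (cong (circuit (suc q)) (sym (+-identityʳ _)))
  (trans (circuit-high q 0) (sym (circuit-closed q)))

circuit-< : ∀ q x → circuit q x < suc (q + q)
circuit-< zero    x = z<s
circuit-< (suc q) x with x <? q * suc (q + q)
... | yes x< rewrite circuit-low q x x< = ≤-trans (circuit-< q x) (s≤s (+-mono-≤ (n≤1+n q) (n≤1+n q)))
... | no x≮ with y , refl ← m≤n⇒∃[o]m+o≡n (≮⇒≥ x≮) rewrite circuit-high q y | +-suc q q = petal-< (suc (q + q)) y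

Joins : (ℕ → ℕ) → ℕ → ℕ → ℕ → Set
Joins f x i k = (f x ≡ i × f (suc x) ≡ k) ⊎ (f x ≡ k × f (suc x) ≡ i)

-- At time `2i` the petal is at `i`; the steps just before and just after lead to the two new
-- vertices, and the parity of `i` decides which comes after. The edge from `0` to `n` is the
-- closing step.
petal-joins : ∀ n i k → even n ≡ false → i < k → k ≡ n ⊎ k ≡ suc n →
  ∃[ y ] y < suc (n + n) × Joins (petal n) y i k
petal-joins n i .(suc n) odd i<k (inj₂ refl) with even i in eq
... | true = i + i , s<s (+-mono-≤ (<⇒≤ i<n) (<⇒≤ i<n)) , inj₁ (petal-even n i (<⇒≤ i<n) ,
    trans (petal-odd n i i<n) (cong (λ b → if b then suc n else n) eq))
  where
  i<n : i < n
  i<n = ≤∧≢⇒< (s≤s⁻¹ i<k) λ { refl → contradiction (trans (sym eq) odd) λ () }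
petal-joins n (suc j) .(suc n) odd (s<s j<n) (inj₂ refl) | false =
  suc (j + j) , s<s (+-mono-< j<n j<n) ,
  inj₂ (trans (petal-odd n j j<n) (cong (λ b → if b then suc n else n) even-j) ,
    trans (cong (petal n) (cong suc (sym (+-suc j j)))) (petal-even n (suc j) j<n))
  where
  even-j : even j ≡ true
  even-j = trans (sym (not-involutive (even j))) (cong not eq)
petal-joins n zero .n odd i<n (inj₁ refl) =
  n + n , ≤-refl , inj₂ (petal-even n n ≤-refl , petal-end n)
petal-joins n (suc j) .n odd i<n (inj₁ refl) with even j in eq
... | true = suc j + suc j , s<s (+-mono-≤ (<⇒≤ i<n) (<⇒≤ i<n)) , inj₁ (petal-even n (suc j) (<⇒≤ i<n) ,
    trans (petal-odd n (suc j) i<n) (cong (λ b → if not b then suc n else n) eq))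
... | false = suc (j + j) , s<s (+-mono-< j<n j<n) ,
  inj₂ (trans (petal-odd n j j<n) (cong (λ b → if b then suc n else n) eq) ,
    trans (cong (petal n) (cong suc (sym (+-suc j j)))) (petal-even n (suc j) j<n))
  where
  j<n : j < n
  j<n = <⇒≤ i<n

-- If `k` is not one of the two newest vertices, the edge lies on the smaller circuit, otherwise on
-- the last petal. Finding each edge once is enough, since there are as many steps as edges.
circuit-joins : ∀ q i k → i < k → k < suc (q + q) → ∃[ x ] x < q * suc (q + q) × Joins (circuit q) x i k
circuit-joins zero i (suc k) i<k (s<s ())
circuit-joins (suc q) i k i<k k< with k <? suc (q + q)
... | yes k<′ with x , x< , joins ← circuit-joins q i k i<k k<′ =
  x , ≤-trans x< (subst (q * suc (q + q) ≤_) (sym (circuit-length q)) (m≤m+n _ _)) ,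
  subst₂ (λ a b → (a ≡ i × b ≡ k) ⊎ (a ≡ k × b ≡ i)) (sym (circuit-low q x x<)) (sym (circuit-low′ q (suc x) x<)) joins
... | no k≮ =
  let y , y< , joins = petal-joins (suc (q + q)) i k (cong not (even-double q)) i<k cases in
  L + y , subst (L + y <_) (sym (circuit-length q)) (+-monoʳ-< L y<) ,
  subst₂ (λ a b → (a ≡ i × b ≡ k) ⊎ (a ≡ k × b ≡ i)) (sym (circuit-high q y))
    (sym (trans (cong (circuit (suc q)) (sym (+-suc L y))) (circuit-high q (suc y)))) joins
  where
  L = q * suc (q + q)
  cases : k ≡ suc (q + q) ⊎ k ≡ suc (suc (q + q))
  cases with m≤n⇒m<n∨m≡n (≮⇒≥ k≮)
  ... | inj₂ eq = inj₁ (sym eq)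
  ... | inj₁ lt = inj₂ (≤-antisym (s≤s⁻¹ (subst (k <_) (cong 2+ (+-suc q q)) k<)) lt)

δ-disjoint : ∀ v {a b} → a ≢ b → δ v a + δ v b ≤ 1
δ-disjoint v {a} {b} a≢b with v ≟ a
... | yes refl rewrite δ-refl v | δ-≢ a≢b = ≤-refl
... | no v≢a rewrite δ-≢ v≢a with v ≡ᵇ b
...   | true  = ≤-refl
...   | false = z≤n

∑-δʳ : ∀ n v → ∑ n (δ v) ≤ 1
∑-δʳ zero    v       = z≤n
∑-δʳ (suc n) zero    = ≤-reflexive (cong suc (∑-zero n λ _ _ → refl))
∑-δʳ (suc n) (suc v) = ∑-δʳ n v

petal-visits : ∀ n v → ∑ (suc (n + n)) (δ v ∘ petal n) ≡
  ∑ n (δ v) + (∑ n (λ j → δ v (if even j then suc n else n)) + δ v n)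
petal-visits n v = begin
  ∑ (suc (n + n)) f                                                     ≡⟨ ∑-last (n + n) f ⟩
  ∑ (n + n) f + f (n + n)                                               ≡⟨ cong (_+ f (n + n)) (∑-double n f) ⟩
  ∑ n (λ j → f (j + j) + f (suc (j + j))) + f (n + n)
    ≡⟨ cong₂ _+_ (∑-cong n λ j j<n → cong₂ (λ a b → δ v a + δ v b) (petal-even n j (<⇒≤ j<n)) (petal-odd n j j<n))
         (cong (δ v) (petal-even n n ≤-refl)) ⟩
  ∑ n (λ j → δ v j + far j) + δ v n                                     ≡⟨ cong (_+ δ v n) (∑-+ n (δ v) far) ⟩
  ∑ n (δ v) + ∑ n far + δ v n                                           ≡⟨ +-assoc (∑ n (δ v)) _ _ ⟩
  ∑ n (δ v) + (∑ n far + δ v n)                                         ∎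
  where
  open ≡-Reasoning
  f far : ℕ → ℕ
  f = δ v ∘ petal n
  far j = δ v (if even j then suc n else n)

-- The last petal passes every old vertex once. Its odd times alternate between `n + 1` and `n`,
-- beginning and ending with `n + 1`; with the stop at `n` at time `2n` they form `q + 1` pairs of
-- different vertices.
circuit-visits : ∀ q v → ∑ (q * suc (q + q)) (δ v ∘ circuit q) ≤ q
circuit-visits zero    v = z≤n
circuit-visits (suc q) v = begin
  ∑ (suc q * suc (suc q + suc q)) f                  ≡⟨ cong (λ l → ∑ l f) (circuit-length q) ⟩
  ∑ (L + suc (n + n)) f                              ≡⟨ ∑-split L (suc (n + n)) f ⟩
  ∑ L f + ∑ (suc (n + n)) (λ y → f (L + y))
    ≡⟨ cong₂ _+_ (∑-cong L λ x x< → cong (δ v) (circuit-low q x x<))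
         (∑-cong (suc (n + n)) λ y _ → cong (δ v) (circuit-high q y)) ⟩
  ∑ L (δ v ∘ circuit q) + ∑ (suc (n + n)) (δ v ∘ petal n)
    ≡⟨ cong (∑ L (δ v ∘ circuit q) +_) (petal-visits n v) ⟩
  ∑ L (δ v ∘ circuit q) + (∑ n (δ v) + (∑ n far + δ v n)) ≤⟨ bound ⟩
  suc q                                              ∎
  where
  open ≤-Reasoning
  L = q * suc (q + q)
  n = suc (q + q)
  f far : ℕ → ℕ
  f = δ v ∘ circuit (suc q)
  far j = δ v (if even j then suc n else n)
  far-bound : ∑ n far + δ v n ≤ suc q
  far-bound = begin
    ∑ n far + δ v n                                                   ≡⟨ cong (_+ δ v n) (∑-last (q + q) far) ⟩
    ∑ (q + q) far + far (q + q) + δ v n                               ≡⟨ +-assoc (∑ (q + q) far) _ _ ⟩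
    ∑ (q + q) far + (far (q + q) + δ v n)                             ≡⟨ cong (_+ (far (q + q) + δ v n)) (∑-double q far) ⟩
    ∑ q (λ j → far (j + j) + far (suc (j + j))) + (far (q + q) + δ v n) ≤⟨ +-mono-≤ (∑-mono q λ j _ → pair j) last-pair ⟩
    ∑ q (λ _ → 1) + 1                                                 ≡⟨ cong (_+ 1) (trans (∑-const q 1) (*-identityʳ q)) ⟩
    q + 1                                                             ≡⟨ +-comm q 1 ⟩
    suc q                                                             ∎
    where
    pair : ∀ j → far (j + j) + far (suc (j + j)) ≤ 1
    pair j rewrite even-double j = δ-disjoint v {suc n} {n} 1+n≢n
    last-pair : far (q + q) + δ v n ≤ 1
    last-pair rewrite even-double q = δ-disjoint v {suc n} {n} 1+n≢n
  bound : ∑ L (δ v ∘ circuit q) + (∑ n (δ v) + (∑ n far + δ v n)) ≤ suc q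
  bound with v <? n
  ... | yes v<n = begin
    ∑ L (δ v ∘ circuit q) + (∑ n (δ v) + (∑ n far + δ v n))
      ≡⟨ cong (λ z → ∑ L (δ v ∘ circuit q) + (∑ n (δ v) + z)) (cong₂ _+_ (∑-zero n λ j _ → far-0 j) (δ-≢ (<⇒≢ v<n))) ⟩
    ∑ L (δ v ∘ circuit q) + (∑ n (δ v) + 0) ≤⟨ +-mono-≤ (circuit-visits q v) (≤-trans (≤-reflexive (+-identityʳ _)) (∑-δʳ n v)) ⟩
    q + 1                                   ≡⟨ +-comm q 1 ⟩
    suc q                                   ∎
    where
    far-0 : ∀ j → far j ≡ 0
    far-0 j with even j
    ... | true  = δ-≢ (<⇒≢ (<-trans v<n ≤-refl))
    ... | false = δ-≢ (<⇒≢ v<n)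
  ... | no v≮n = begin
    ∑ L (δ v ∘ circuit q) + (∑ n (δ v) + (∑ n far + δ v n))
      ≡⟨ cong₂ (λ a b → a + (b + (∑ n far + δ v n)))
           (∑-zero L λ x _ → δ-≢ {v} {circuit q x} λ { refl → v≮n (circuit-< q x) })
           (∑-zero n {δ v} λ j j<n → δ-≢ {v} {j} λ { refl → v≮n j<n }) ⟩
    ∑ n far + δ v n ≤⟨ far-bound ⟩
    suc q           ∎

-- Orderings of a cycle

-- `rank` orders the edges {x , x + 1} of the cycle ℤ/E so that any s cyclically consecutive
-- ones form a matching; the latter is expressed by weights on the vertices of the cycle.
record CycleOrdering (E s : ℕ) .{{_ : NonZero E}} : Set where
  field
    rank    : ℕ → ℕ
    unrank  : ℕ → ℕ
    rank<   : ∀ x → x < E → rank x < E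
    inverse : ∀ x → x < E → unrank (rank x) ≡ x
    matching : ∀ g → Periodic E g → ∀ k → k < E →
      ∑ s (λ i → g (unrank ((k + i) % E)) + g (suc (unrank ((k + i) % E)))) ≤ ∑ E g

periodic-% : ∀ E .{{_ : NonZero E}} g → Periodic E g → ∀ x → g (x % E) ≡ g x
periodic-% E g per x = sym (trans (cong g (m≡m%n+[m/n]*n x E)) (go (x / E) (x % E)))
  where
  go : ∀ k y → g (y + k * E) ≡ g y
  go zero    y = cong g (+-identityʳ y)
  go (suc k) y = trans (cong g (trans (cong (y +_) (+-comm E (k * E))) (sym (+-assoc y _ E)))) (trans (per (y + k * E)) (go k y))

-- For odd E, the p-th edge is {2p , 2p + 1}, so windows cover runs of consecutive vertices.
oddCycle : ∀ s → CycleOrdering (suc (s + s)) s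
oddCycle s = record
  -- `suc s` is the inverse of 2 modulo `E = 2s + 1`.
  { rank     = λ x → (x * suc s) % E
  ; unrank   = λ p → (p + p) % E
  ; rank<    = λ x _ → m%n<n (x * suc s) E
  ; inverse  = λ x x<E → begin
      ((x * suc s) % E + (x * suc s) % E) % E ≡⟨ %-distribˡ-+ (x * suc s) (x * suc s) E ⟨
      (x * suc s + x * suc s) % E             ≡⟨ cong (_% E) (lemma x s) ⟩
      (x + x * E) % E                         ≡⟨ [m+kn]%n≡m%n x x E ⟩
      x % E                                   ≡⟨ m<n⇒m%n≡m x<E ⟩
      x                                       ∎
  ; matching = matching
  }
  where
  open ≡-Reasoning
  E = suc (s + s)
  lemma : ∀ x s → x * suc s + x * suc s ≡ x + x * suc (s + s)
  lemma = solve-∀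
  shuffle : ∀ k i → (k + i) + (k + i) ≡ (k + k) + (i + i)
  shuffle = solve-∀
  matching : ∀ g → Periodic E g → ∀ k → k < E →
    ∑ s (λ i → g (((k + i) % E + (k + i) % E) % E) + g (suc (((k + i) % E + (k + i) % E) % E))) ≤ ∑ E g
  matching g per k _ = subst₂ _≤_ (sym window) (∑-period per (k + k)) (∑-≤-length (λ j → g (k + k + j)) (n≤1+n (s + s)))
    where
    double : ∀ y → (y % E + y % E) % E ≡ (y + y) % E
    double y = sym (%-distribˡ-+ y y E)
    term : ∀ i → g (((k + i) % E + (k + i) % E) % E) + g (suc (((k + i) % E + (k + i) % E) % E)) ≡
                 g (k + k + (i + i)) + g (k + k + suc (i + i))
    term i = cong₂ _+_
      (trans (cong g (double (k + i))) (trans (periodic-% E g per (k + i + (k + i))) (cong g (shuffle k i))))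
      (trans (cong (g ∘ suc) (double (k + i))) (trans (periodic-% E (g ∘ suc) (per ∘ suc) (k + i + (k + i)))
        (cong g (trans (cong suc (shuffle k i)) (sym (+-suc (k + k) (i + i)))))))
    window : ∑ s (λ i → g (((k + i) % E + (k + i) % E) % E) + g (suc (((k + i) % E + (k + i) % E) % E))) ≡
             ∑ (s + s) (λ j → g (k + k + j))
    window = trans (∑-cong s λ i _ → term i) (sym (∑-double s (λ j → g (k + k + j))))

∑-last₂ : ∀ n f → ∑ (2+ n) f ≡ ∑ n f + (f n + f (suc n))
∑-last₂ n f = trans (∑-last (suc n) f) (trans (cong (_+ f (suc n)) (∑-last n f)) (+-assoc (∑ n f) _ _))

-- A cycle cut open at 0: `right i` is the weight of vertex i, `left i` that of vertex −1−i.
-- Both halves of the ordering grow an arc around 0, alternately on either side.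
module TwoSided (right left : ℕ → ℕ) where

  before : ℕ → ℕ
  before zero    = right 0
  before (suc i) = left i

  onRight onLeft first second : ℕ → ℕ
  onRight i = right i + right (suc i)
  onLeft i  = left i + before i
  first i   = if even i then onLeft i else onRight i
  second i  = if even i then onRight i else onLeft i

  -- The vertices -l, ..., r - 1.
  arc : ℕ → ℕ → ℕ
  arc l r = ∑ l left + ∑ r right

  arc-grow : ∀ l r → arc l r ≤ arc (suc l) (suc r)
  arc-grow l r = +-mono-≤ (∑-≤-length left (n≤1+n l)) (∑-≤-length right (n≤1+n r))

  extend-right : ∀ l r → arc l r + onRight r ≡ arc l (2+ r)
  extend-right l r = trans (+-assoc (∑ l left) _ _) (cong (∑ l left +_) (sym (∑-last₂ r right)))

  extend-left : ∀ l r → arc l r + onLeft (suc l) ≡ arc (2+ l) r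
  extend-left l r = begin
    ∑ l left + ∑ r right + (left (suc l) + left l) ≡⟨ lemma (∑ l left) (∑ r right) (left (suc l)) (left l) ⟩
    ∑ l left + (left l + left (suc l)) + ∑ r right ≡⟨ cong (_+ ∑ r right) (∑-last₂ l left) ⟨
    ∑ (2+ l) left + ∑ r right                      ∎
    where
    open ≡-Reasoning
    lemma : ∀ a b c d → a + b + (c + d) ≡ a + (d + c) + b
    lemma = solve-∀

  second-odd : ∀ b → second (suc (b + b)) ≡ onLeft (suc (b + b))
  second-odd b rewrite even-double b = refl

  second-even : ∀ b → second (b + b) ≡ onRight (b + b)
  second-even b rewrite even-double b = refl

  first-odd : ∀ b → first (suc (b + b)) ≡ onRight (suc (b + b))
  first-odd b rewrite even-double b = refl

  first-even : ∀ b → first (b + b) ≡ onLeft (b + b)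
  first-even b rewrite even-double b = refl

  ∑second-even : ∀ b → ∑ (b + b) second ≡ arc (b + b) (b + b)
  ∑second-odd : ∀ b → ∑ (suc (b + b)) second ≡ arc (b + b) (2+ (b + b))
  ∑second-even zero = refl
  ∑second-even (suc b) rewrite +-suc b b = begin
    ∑ (2+ (b + b)) second                            ≡⟨ ∑-last (suc (b + b)) second ⟩
    ∑ (suc (b + b)) second + second (suc (b + b))    ≡⟨ cong₂ _+_ (∑second-odd b) (second-odd b) ⟩
    arc (b + b) (2+ (b + b)) + onLeft (suc (b + b))  ≡⟨ extend-left (b + b) (2+ (b + b)) ⟩
    arc (2+ (b + b)) (2+ (b + b))                    ∎
    where open ≡-Reasoning
  ∑second-odd b = begin
    ∑ (suc (b + b)) second                           ≡⟨ ∑-last (b + b) second ⟩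
    ∑ (b + b) second + second (b + b)                ≡⟨ cong₂ _+_ (∑second-even b) (second-even b) ⟩
    arc (b + b) (b + b) + onRight (b + b)            ≡⟨ extend-right (b + b) (b + b) ⟩
    arc (b + b) (2+ (b + b))                         ∎
    where open ≡-Reasoning

  ∑first-odd : ∀ b → ∑ (suc (b + b)) first ≡ arc (suc (b + b)) (suc (b + b))
  ∑first-even : ∀ b → ∑ (2+ (b + b)) first ≡ arc (suc (b + b)) (2+ (suc (b + b)))
  ∑first-odd zero = lemma (left 0) (right 0)
    where
    lemma : ∀ l r → l + r + 0 ≡ l + 0 + (r + 0)
    lemma = solve-∀
  ∑first-odd (suc b) rewrite +-suc b b = begin
    ∑ (2+ (suc (b + b))) first                        ≡⟨ ∑-last (2+ (b + b)) first ⟩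
    ∑ (2+ (b + b)) first + first (2+ (b + b))
      ≡⟨ cong₂ _+_ (∑first-even b) (subst (λ i → first i ≡ onLeft i) (cong suc (+-suc b b)) (first-even (suc b))) ⟩
    arc (suc (b + b)) (2+ (suc (b + b))) + onLeft (2+ (b + b)) ≡⟨ extend-left (suc (b + b)) (2+ (suc (b + b))) ⟩
    arc (2+ (suc (b + b))) (2+ (suc (b + b)))         ∎
    where open ≡-Reasoning
  ∑first-even b = begin
    ∑ (2+ (b + b)) first                                  ≡⟨ ∑-last (suc (b + b)) first ⟩
    ∑ (suc (b + b)) first + first (suc (b + b))           ≡⟨ cong₂ _+_ (∑first-odd b) (first-odd b) ⟩
    arc (suc (b + b)) (suc (b + b)) + onRight (suc (b + b)) ≡⟨ extend-right (suc (b + b)) (suc (b + b)) ⟩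
    arc (suc (b + b)) (2+ (suc (b + b)))                  ∎
    where open ≡-Reasoning

  -- Both prefixes cover arcs around 0, and the arc of the longer prefix reaches one vertex further
  -- on either side.
  second≤first : ∀ a → ∑ a second ≤ ∑ (suc a) first
  second≤first a with even-split a
  ... | inj₁ (b , refl) = subst₂ _≤_ (sym (∑second-even b)) (sym (∑first-odd b)) (arc-grow (b + b) (b + b))
  ... | inj₂ (b , refl) = subst₂ _≤_ (sym (∑second-odd b)) (sym (∑first-even b)) (arc-grow (b + b) (2+ (b + b)))

  first≤second : ∀ a → ∑ a first ≤ ∑ (suc a) second
  first≤second zero = z≤n
  first≤second (suc a) with even-split a
  ... | inj₁ (b , refl) = subst₂ _≤_ (sym (∑first-odd b))
    (sym (subst (λ i → ∑ i second ≡ arc i i) (cong suc (+-suc b b)) (∑second-even (suc b)))) (arc-grow (suc (b + b)) (suc (b + b)))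
  ... | inj₂ (b , refl) = subst₂ _≤_ (sym (∑first-even b))
    (sym (subst (λ i → ∑ (suc i) second ≡ arc i (2+ i)) (cong suc (+-suc b b)) (∑second-odd (suc b)))) (arc-grow (suc (b + b)) (2+ (suc (b + b))))

  -- After `K` edges the arc has `2K` vertices; on a cycle of that length it goes round exactly
  -- once, which is what `closed` encodes.
  ∑first≤ : ∀ W K → (∀ l r → l + r ≡ K + K → arc l r ≤ W) → ∑ K first ≤ W
  ∑first≤ W zero    closed = z≤n
  ∑first≤ W (suc a) closed with even-split a
  ... | inj₁ (b , refl) = subst (_≤ W) (sym (∑first-odd b)) (closed (suc (b + b)) (suc (b + b)) refl)
  ... | inj₂ (b , refl) = subst (_≤ W) (sym (∑first-even b)) (closed (suc (b + b)) (2+ (suc (b + b))) (+-suc (suc (b + b)) (suc (suc (b + b)))))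

  ∑second≤ : ∀ W K → (∀ l r → l + r ≡ K + K → arc l r ≤ W) → ∑ K second ≤ W
  ∑second≤ W K closed with even-split K
  ... | inj₁ (b , refl) = subst (_≤ W) (sym (∑second-even b)) (closed (b + b) (b + b) refl)
  ... | inj₂ (b , refl) = subst (_≤ W) (sym (∑second-odd b)) (closed (b + b) (2+ (b + b)) (+-suc (b + b) (suc (b + b))))

-- A window that starts in one block and ends in the next trades a longer prefix of the first
-- block for a shorter prefix of the second.
∑-two-blocks : ∀ s (P Q : ℕ → ℕ) {W} → (∀ a → ∑ a Q ≤ ∑ (suc a) P) → ∑ (suc s) P ≤ W →
  (F : ℕ → ℕ) → (∀ i → i < suc s → F i ≡ P i) → (∀ i → i < suc s → F (suc s + i) ≡ Q i) →
  ∀ a → a < suc s → ∑ s (λ i → F (a + i)) ≤ W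
∑-two-blocks s P Q Q≤P P≤W F F≡P F≡Q zero _ =
  ≤-trans (≤-reflexive (∑-cong s λ i i<s → F≡P i (<-trans i<s ≤-refl))) (≤-trans (∑-≤-length P (n≤1+n s)) P≤W)
∑-two-blocks s P Q {W} Q≤P P≤W F F≡P F≡Q (suc a) (s<s a<s) with c , refl ← m≤n⇒∃[o]m+o≡n a<s = begin
  ∑ (suc a + c) (λ i → F (suc a + i))                                     ≡⟨ cong (λ l → ∑ l G) (lemma a c) ⟩
  ∑ (suc c + a) G                                                         ≡⟨ ∑-split (suc c) a G ⟩
  ∑ (suc c) G + ∑ a (λ i → G (suc c + i))                                 ≡⟨ cong₂ _+_ (∑-cong (suc c) inP) (∑-cong a inQ) ⟩
  ∑ (suc c) (λ i → P (suc a + i)) + ∑ a Q                                 ≤⟨ +-monoʳ-≤ _ (Q≤P a) ⟩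
  ∑ (suc c) (λ i → P (suc a + i)) + ∑ (suc a) P                           ≡⟨ +-comm _ (∑ (suc a) P) ⟩
  ∑ (suc a) P + ∑ (suc c) (λ i → P (suc a + i))                           ≡⟨ ∑-split (suc a) (suc c) P ⟨
  ∑ (suc a + suc c) P                                                     ≡⟨ cong (λ l → ∑ l P) (+-suc (suc a) c) ⟩
  ∑ (suc (suc a + c)) P                                                   ≤⟨ P≤W ⟩
  W                                                                       ∎
  where
  open ≤-Reasoning
  G : ℕ → ℕ
  G i = F (suc a + i)
  lemma : ∀ a c → suc a + c ≡ suc c + a
  lemma = solve-∀
  inP : ∀ i → i < suc c → G i ≡ P (suc a + i)
  inP i i<c = F≡P (suc a + i) (subst (suc a + i <_) (+-suc (suc a) c) (+-monoʳ-< (suc a) i<c))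
  shift : ∀ a c i → suc a + (suc c + i) ≡ suc (suc a + c) + i
  shift = solve-∀
  inQ : ∀ i → i < a → G (suc c + i) ≡ Q i
  inQ i i<a = trans (cong F (shift a c i)) (F≡Q i (≤-trans i<a (≤-trans (n≤1+n a) (≤-trans (m≤m+n (suc a) c) (n≤1+n _)))))

∑-reverse : ∀ l r (f : ℕ → ℕ) → ∑ l (λ j → f (l + r ∸ suc j)) ≡ ∑ l (λ i → f (r + i))
∑-reverse zero    r f = refl
∑-reverse (suc l) r f = begin
  f (l + r) + ∑ l (λ j → f (l + r ∸ suc j)) ≡⟨ cong₂ _+_ (cong f (+-comm l r)) (∑-reverse l r f) ⟩
  f (r + l) + ∑ l (λ i → f (r + i))         ≡⟨ +-comm (f (r + l)) _ ⟩
  ∑ l (λ i → f (r + i)) + f (r + l)         ≡⟨ ∑-last l (λ i → f (r + i)) ⟨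
  ∑ (suc l) (λ i → f (r + i))               ∎
  where open ≡-Reasoning

even-+ : ∀ m n → even (m + n) ≡ true → even m ≡ even n
even-+ zero    n eq = sym eq
even-+ (suc m) n eq = trans (cong not (even-+ m (suc n) (trans (cong even (+-suc m n)) eq))) (not-involutive (even n))

-- The two halves are the perfect matchings of the cycle: first the edges {x , x + 1} with `x` odd,
-- then those with `x` even. The reflection x ↦ -1 - x, written `E ∸ suc x`, changes parity; this
-- explains the tests on `even`.
evenCycle : ∀ s → CycleOrdering (suc s + suc s) s
evenCycle s = record { rank = rank; unrank = unrank; rank< = rank<; inverse = inverse; matching = matching }
  where
  K = suc s
  E = K + K
  rank unrank : ℕ → ℕ
  rank x = if x <ᵇ K
    then (if even x then K + x else x)
    else (if even x then K + (E ∸ suc x) else E ∸ suc x)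
  unrank p = if p <ᵇ K
    then (if even p then E ∸ suc p else p)
    else (if even (p ∸ K) then p ∸ K else E ∸ suc (p ∸ K))

  module _ (x : ℕ) (K≤x : K ≤ x) (x<E : x < E) where
    mirror : E ∸ suc x + suc x ≡ E
    mirror = m∸n+n≡m x<E
    mirror<K : E ∸ suc x < K
    mirror<K = +-cancelʳ-≤ K (suc (E ∸ suc x)) K (begin
      suc (E ∸ suc x) + K ≡⟨ +-suc (E ∸ suc x) K ⟨
      E ∸ suc x + suc K   ≤⟨ +-monoʳ-≤ (E ∸ suc x) (s≤s K≤x) ⟩
      E ∸ suc x + suc x   ≡⟨ mirror ⟩
      K + K               ∎)
      where open ≤-Reasoning
    even-mirror : even (E ∸ suc x) ≡ not (even x)
    even-mirror = even-+ (E ∸ suc x) (suc x) (trans (cong even mirror) (even-double K))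
    mirror-mirror : E ∸ suc (E ∸ suc x) ≡ x
    mirror-mirror = trans (cong (_∸ suc (E ∸ suc x)) (trans (sym mirror) (+-suc (E ∸ suc x) x))) (m+n∸m≡n (E ∸ suc x) x)

  rank< : ∀ x → x < E → rank x < E
  rank< x x<E with x <? K
  ... | yes x<K rewrite <ᵇ-true x<K with even x
  ...   | true  = +-monoʳ-< K x<K
  ...   | false = x<E
  rank< x x<E | no x≮K rewrite <ᵇ-false (≮⇒≥ x≮K) with even x
  ...   | true  = +-monoʳ-< K (mirror<K x (≮⇒≥ x≮K) x<E)
  ...   | false = ≤-trans (mirror<K x (≮⇒≥ x≮K) x<E) (m≤m+n K K)

  unrank-first : ∀ a → a < K → unrank a ≡ (if even a then E ∸ suc a else a)
  unrank-first a a<K rewrite <ᵇ-true a<K = refl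

  unrank-second : ∀ a → unrank (K + a) ≡ (if even a then a else E ∸ suc a)
  unrank-second a rewrite <ᵇ-false (m≤m+n K a) | m+n∸m≡n K a = refl

  inverse : ∀ x → x < E → unrank (rank x) ≡ x
  inverse x x<E with x <? K
  inverse x x<E | yes x<K rewrite <ᵇ-true x<K with even x in eq
  ... | true  = trans (unrank-second x) (cong (λ b → if b then x else E ∸ suc x) eq)
  ... | false = trans (unrank-first x x<K) (cong (λ b → if b then E ∸ suc x else x) eq)
  inverse x x<E | no x≮K rewrite <ᵇ-false (≮⇒≥ x≮K) with even x in eq
  ... | true  = trans (unrank-second a) (trans (cong (λ b → if b then a else E ∸ suc a)
      (trans (even-mirror x (≮⇒≥ x≮K) x<E) (cong not eq))) (mirror-mirror x (≮⇒≥ x≮K) x<E))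
    where a = E ∸ suc x
  ... | false = trans (unrank-first a (mirror<K x (≮⇒≥ x≮K) x<E)) (trans (cong (λ b → if b then E ∸ suc a else a)
      (trans (even-mirror x (≮⇒≥ x≮K) x<E) (cong not eq))) (mirror-mirror x (≮⇒≥ x≮K) x<E))
    where a = E ∸ suc x

  matching : ∀ g → Periodic E g → ∀ k → k < E →
    ∑ s (λ i → g (unrank ((k + i) % E)) + g (suc (unrank ((k + i) % E)))) ≤ ∑ E g
  matching g per k k<E = window
    where
    open TwoSided g (λ i → g (E ∸ suc i))
    F : ℕ → ℕ
    F p = g (unrank (p % E)) + g (suc (unrank (p % E)))
    onLeft-≡ : ∀ i → i < K → g (E ∸ suc i) + g (suc (E ∸ suc i)) ≡ onLeft i
    onLeft-≡ i i<K = cong (g (E ∸ suc i) +_) (trans (cong g (sym (+-∸-assoc 1 (≤-trans i<K (m≤m+n K K))))) (before-≡ i))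
      where
      before-≡ : ∀ i → g (E ∸ i) ≡ before i
      before-≡ zero    = per 0
      before-≡ (suc i) = refl
    F-first : ∀ i → i < K → F i ≡ first i
    F-first i i<K rewrite m<n⇒m%n≡m {n = E} (≤-trans i<K (m≤m+n K K)) | unrank-first i i<K with even i
    ... | true  = onLeft-≡ i i<K
    ... | false = refl
    F-second : ∀ i → i < K → F (K + i) ≡ second i
    F-second i i<K rewrite m<n⇒m%n≡m {n = E} (+-monoʳ-< K i<K) | unrank-second i with even i
    ... | true  = refl
    ... | false = onLeft-≡ i i<K
    F-wrap : ∀ i → i < K → F (K + (K + i)) ≡ first i
    F-wrap i i<K = trans (cong (λ y → g (unrank y) + g (suc (unrank y)))
      (trans (cong (_% E) (trans (sym (+-assoc K K i)) (+-comm E i))) ([m+n]%n≡m%n i E))) (F-first i i<K)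
    closed : ∀ l r → l + r ≡ K + K → arc l r ≤ ∑ E g
    closed l r eq = ≤-reflexive (begin
      ∑ l (λ i → g (E ∸ suc i)) + ∑ r g       ≡⟨ cong (λ e → ∑ l (λ i → g (e ∸ suc i)) + ∑ r g) eq ⟨
      ∑ l (λ i → g (l + r ∸ suc i)) + ∑ r g   ≡⟨ cong (_+ ∑ r g) (∑-reverse l r g) ⟩
      ∑ l (λ i → g (r + i)) + ∑ r g           ≡⟨ +-comm _ (∑ r g) ⟩
      ∑ r g + ∑ l (λ i → g (r + i))           ≡⟨ ∑-split r l g ⟨
      ∑ (r + l) g                             ≡⟨ cong (λ e → ∑ e g) (trans (+-comm r l) eq) ⟩
      ∑ E g                                   ∎)
      where open ≡-Reasoning
    window : ∑ s (λ i → F (k + i)) ≤ ∑ E g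
    window with k <? K
    ... | yes k<K = ∑-two-blocks s first second second≤first (∑first≤ (∑ E g) K closed) F F-first F-second k k<K
    ... | no k≮K with a , refl ← m≤n⇒∃[o]m+o≡n (≮⇒≥ k≮K) =
      ≤-trans (≤-reflexive (∑-cong s λ i _ → cong F (+-assoc K a i)))
        (∑-two-blocks s second first first≤second (∑second≤ (∑ E g) K closed) (λ i → F (K + i)) F-second F-wrap a
          (+-cancelˡ-< K a K k<E))

-- Odd n

module OddOrder (q s : ℕ) (1≤q : 1 ≤ q) where

  n E : ℕ
  n = suc (q + q)
  E = q * suc (q + q)

  instance
    E≢0 : NonZero E
    E≢0 = >-nonZero (*-mono-≤ 1≤q z<s)

  numEdges≡E : numEdges n ≡ E
  numEdges≡E = numEdges-unique (q + q) (lemma q)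
    where
    lemma : ∀ q → 2 * (q * suc (q + q)) ≡ suc (q + q) * (q + q)
    lemma = solve-∀

  onCircuit : (e : Edge n) → ∃[ x ] x < E × Joins (circuit q) x (toℕ (proj₁ e)) (toℕ (proj₁ (proj₂ e)))
  onCircuit (i , j , i<j) = circuit-joins q (toℕ i) (toℕ j) i<j (toℕ<n j)

  position : Edge n → ℕ
  position e = proj₁ (onCircuit e)

  position< : ∀ e → position e < E
  position< e = proj₁ (proj₂ (onCircuit e))

  -- A step of the circuit has just one pair of ends, and a crossed match of ends contradicts their
  -- order.
  position-injective : ∀ {e e′} → position e ≡ position e′ → e ≡ e′
  position-injective {e@(i , j , i<j)} {e′@(i′ , j′ , i′<j′)} eq
    with onCircuit e | onCircuit e′
  position-injective {i , j , i<j} {i′ , j′ , i′<j′} refl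
    | x , _ , inj₁ (a , b) | .x , _ , inj₁ (c , d) =
      edge-≡ (toℕ-injective (trans (sym a) c)) (toℕ-injective (trans (sym b) d))
  position-injective {i , j , i<j} {i′ , j′ , i′<j′} refl
    | x , _ , inj₁ (a , b) | .x , _ , inj₂ (c , d) =
      contradiction (subst₂ _<_ (trans (sym a) c) (trans (sym b) d) i<j) (<-asym i′<j′)
  position-injective {i , j , i<j} {i′ , j′ , i′<j′} refl
    | x , _ , inj₂ (a , b) | .x , _ , inj₁ (c , d) =
      contradiction (subst₂ _<_ (trans (sym b) d) (trans (sym a) c) i<j) (<-asym i′<j′)
  position-injective {i , j , i<j} {i′ , j′ , i′<j′} refl
    | x , _ , inj₂ (a , b) | .x , _ , inj₂ (c , d) =
      edge-≡ (toℕ-injective (trans (sym b) d)) (toℕ-injective (trans (sym a) c))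

  visit : ℕ → ℕ → ℕ
  visit v x = δ v (circuit q (x % E))

  visit-≡ : ∀ v x → x ≤ E → visit v x ≡ δ v (circuit q x)
  visit-≡ v x x≤E with m≤n⇒m<n∨m≡n x≤E
  ... | inj₁ x<E = cong (δ v ∘ circuit q) (m<n⇒m%n≡m x<E)
  ... | inj₂ x≡E = cong (δ v) (trans (cong (circuit q) (trans (cong (λ y → _%_ y E {{E≢0}}) x≡E) (n%n≡0 E)))
    (trans (circuit-0 q) (sym (trans (cong (circuit q) x≡E) (circuit-closed q)))))

  inc-visit : ∀ v e → inc v e ≡ visit v (position e) + visit v (suc (position e))
  inc-visit v e with onCircuit e
  ... | x , x<E , joins = trans (ends joins) (sym (cong₂ _+_ (visit-≡ v x (<⇒≤ x<E)) (visit-≡ v (suc x) x<E)))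
    where
    ends : Joins (circuit q) x (toℕ (proj₁ e)) (toℕ (proj₁ (proj₂ e))) →
      inc v e ≡ δ v (circuit q x) + δ v (circuit q (suc x))
    ends (inj₁ (a , b)) = cong₂ (λ a b → δ v a + δ v b) (sym a) (sym b)
    ends (inj₂ (a , b)) = trans (cong₂ (λ a b → δ v a + δ v b) (sym b) (sym a)) (+-comm (δ v (circuit q (suc x))) _)

  cms-odd : CycleOrdering E s → (E ∸ 1) / 2 ≡ s → s ≤ E → 3 ≤ n → q ≤ n ∸ 2 → IsCmsComplete n q ((q * n ∸ 1) / 2)
  cms-odd cycle s≡ s≤E 3≤n q≤ = cms-from-labelling n q s E numEdges≡E 3≤n 1≤q q≤ s≡ s≤E
    (rank ∘ position) (λ e → rank< _ (position< e))
    (λ {e} {e′} eq → position-injective {e} {e′} (trans (sym (inverse _ (position< e))) (trans (cong unrank eq) (inverse _ (position< e′)))))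
    λ v edge label≡ k k<E → begin
      ∑ s (λ i → inc v (edge (k + i)))
        ≡⟨ ∑-cong s (λ i _ → trans (inc-visit v (edge (k + i)))
             (cong (λ x → visit v x + visit v (suc x)) (trans (sym (inverse _ (position< (edge (k + i))))) (cong unrank (label≡ (k + i)))))) ⟩
      ∑ s (λ i → visit v (unrank ((k + i) % E)) + visit v (suc (unrank ((k + i) % E))))
        -- A position weighs 1 if the circuit is at `v` there, so a matching of positions counts
        -- each passage through `v` at most once.
        ≤⟨ matching (visit v) (λ x → cong (δ v ∘ circuit q) ([m+n]%n≡m%n x E)) k k<E ⟩
      ∑ E (visit v)          ≡⟨ ∑-cong E (λ x x<E → visit-≡ v x (<⇒≤ x<E)) ⟩
      ∑ E (δ v ∘ circuit q)  ≤⟨ circuit-visits q v ⟩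
      q                      ∎
    where
    open CycleOrdering cycle
    open ≤-Reasoning

halve-double : ∀ s → (s + s) / 2 ≡ s
halve-double s = trans (cong (_/ 2) (lemma s)) (m*n/n≡m s 2)
  where
  lemma : ∀ s → s + s ≡ s * 2
  lemma = solve-∀

halve-odd : ∀ s → (s + suc s) / 2 ≡ s
halve-odd s = trans (cong (_/ 2) (lemma s))
  (trans (+-distrib-/ 1 (s * 2) (subst (λ r → 1 + r < 2) (sym (m*n%n≡0 s 2)) ≤-refl)) (m*n/n≡m s 2))
  where
  lemma : ∀ s → s + suc s ≡ 1 + s * 2
  lemma = solve-∀

cycleOrdering : ∀ E .{{_ : NonZero E}} → CycleOrdering E ((E ∸ 1) / 2)
cycleOrdering E with even-split E
... | inj₂ (s , refl) = subst (λ t → CycleOrdering (suc (s + s)) t) (sym (halve-double s)) (oddCycle s)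
... | inj₁ (suc s , refl) = subst (λ t → CycleOrdering (suc s + suc s) t) (sym (halve-odd s)) (evenCycle s)

theorem-odd : ∀ q → 3 ≤ suc (q + q) → q ≤ suc (q + q) ∸ 2 →
  IsCmsComplete (suc (q + q)) q ((q * suc (q + q) ∸ 1) / 2)
theorem-odd zero    (s≤s ()) _
theorem-odd q@(suc _) 3≤n q≤ = cms-odd (cycleOrdering E) refl (≤-trans (m/n≤m (E ∸ 1) 2) (m∸n≤m E 1)) 3≤n q≤
  where open OddOrder q ((q * suc (q + q) ∸ 1) / 2) z<s

-- Windows in a sequence of blocks

block-% : ∀ m .{{_ : NonZero m}} t {x} → x < m → (t * m + x) % m ≡ x
block-% m t {x} x<m = trans (cong (_% m) (+-comm (t * m) x)) (trans ([m+kn]%n≡m%n x t m) (m<n⇒m%n≡m x<m))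

block-/ : ∀ m .{{_ : NonZero m}} t {x} → x < m → (t * m + x) / m ≡ t
block-/ m t {x} x<m = trans (+-distrib-/-∣ˡ x (n∣m*n t))
  (trans (cong₂ _+_ (m*n/n≡m t m) (m<n⇒m/n≡0 x<m)) (+-identityʳ t))

block-injective : ∀ m .{{_ : NonZero m}} {t t′ x x′} → x < m → x′ < m →
  t * m + x ≡ t′ * m + x′ → t ≡ t′ × x ≡ x′
block-injective m {t} {t′} x<m x′<m eq =
  trans (sym (block-/ m t x<m)) (trans (cong (_/ m) eq) (block-/ m t′ x′<m)) ,
  trans (sym (block-% m t x<m)) (trans (cong (_% m) eq) (block-% m t′ x′<m))

∑-δ-≤ : ∀ n p → ∑ n (λ x → δ x p) ≤ 1
∑-δ-≤ n p with p <? n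
... | yes p<n = ≤-reflexive (∑-δ n p<n)
... | no p≮n  = subst (_≤ 1) (sym (∑-zero n λ x x<n → δ-≢ {x} {p} λ { refl → p≮n x<n })) z≤n

-- As `s = rm − 1`, a window starting at place `x + 1` of block `t` stops just before place `x` of
-- block `t + r`. It contains `r − 1` full blocks, and the two pieces at its ends must not both
-- contain `v`. The count is done by differences of prefix sums.
blocks-bound : ∀ m .{{_ : NonZero m}} r s (P : ℕ → ℕ) → r * m ≡ suc s →
  (∀ t → P t < m) → (∀ t → P t ≤ suc (P (t + r))) →
  (h : ℕ → ℕ) → (∀ t x → x < m → h (t * m + x) ≤ δ x (P t)) →
  ∀ k → ∑ s (λ i → h (k + i)) ≤ r
blocks-bound m r s P rm≡ P<m P-step h h≤ k = ≤-trans (∑-mono s λ i _ → below (k + i)) bound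
  where
  unit : ℕ → ℕ
  unit y = δ (y % m) (P (y / m))
  split : ∀ y → y ≡ y / m * m + y % m
  split y = trans (m≡m%n+[m/n]*n y m) (+-comm (y % m) _)
  below : ∀ y → h y ≤ unit y
  below y = subst (λ z → h z ≤ unit y) (sym (split y)) (h≤ (y / m) (y % m) (m%n<n y m))
  unit-≡ : ∀ t x → x < m → unit (t * m + x) ≡ δ x (P t)
  unit-≡ t x x<m = cong₂ (λ a b → δ a (P b)) (block-% m t x<m) (block-/ m t x<m)
  count-blocks : ∀ t → ∑ (t * m) unit ≡ t
  count : ∀ t x → x ≤ m → ∑ (t * m + x) unit ≡ t + ∑ x (λ y → δ y (P t))
  count-blocks zero    = refl
  count-blocks (suc t) = begin
    ∑ (m + t * m) unit           ≡⟨ cong (λ l → ∑ l unit) (+-comm m (t * m)) ⟩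
    ∑ (t * m + m) unit           ≡⟨ count t m ≤-refl ⟩
    t + ∑ m (λ y → δ y (P t))    ≡⟨ cong (t +_) (∑-δ m (P<m t)) ⟩
    t + 1                        ≡⟨ +-comm t 1 ⟩
    suc t                        ∎
    where open ≡-Reasoning
  count t x x≤m = trans (∑-split (t * m) x unit)
    (cong₂ _+_ (count-blocks t) (∑-cong x λ y y<x → unit-≡ t y (≤-trans y<x x≤m)))
  bound : ∑ s (λ i → unit (k + i)) ≤ r
  bound = +-cancelˡ-≤ (∑ k unit) _ r (subst (_≤ ∑ k unit + r) (∑-split k s unit) (go (k % m) (m%n<n k m) (split k)))
    where
    t = k / m
    open ≤-Reasoning
    rearrange : ∀ t m r → (t + r) * m ≡ t * m + r * m
    rearrange = solve-∀
    shuffle : ∀ a b r → a + r + b ≡ a + b + r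
    shuffle = solve-∀
    end : ∀ x → t * m + suc x + s ≡ (t + r) * m + x
    end x = trans (lemma (t * m) x s) (cong (_+ x) (trans (cong (t * m +_) (sym rm≡)) (sym (rearrange t m r))))
      where
      lemma : ∀ a x s → a + suc x + s ≡ a + suc s + x
      lemma = solve-∀
    go : ∀ x → x < m → k ≡ t * m + x → ∑ (k + s) unit ≤ ∑ k unit + r
    go zero _ k≡ = begin
      ∑ (k + s) unit           ≤⟨ ∑-≤-length unit k+s≤ ⟩
      ∑ ((t + r) * m) unit     ≡⟨ count-blocks (t + r) ⟩
      t + r                    ≡⟨ cong (_+ r) (count-blocks t) ⟨
      ∑ (t * m) unit + r       ≡⟨ cong (λ y → ∑ y unit + r) (trans k≡ (+-identityʳ (t * m))) ⟨
      ∑ k unit + r             ∎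
      where
      k+s≤ : k + s ≤ (t + r) * m
      k+s≤ = begin
        k + s               ≡⟨ cong (_+ s) (trans k≡ (+-identityʳ (t * m))) ⟩
        t * m + s           ≤⟨ +-monoʳ-≤ (t * m) (n≤1+n s) ⟩
        t * m + suc s       ≡⟨ cong (t * m +_) rm≡ ⟨
        t * m + r * m       ≡⟨ rearrange t m r ⟨
        (t + r) * m         ∎
    go (suc x) x<m k≡ = begin
      ∑ (k + s) unit                                ≡⟨ cong (λ y → ∑ y unit) (trans (cong (_+ s) k≡) (end x)) ⟩
      ∑ ((t + r) * m + x) unit                      ≡⟨ count (t + r) x (<⇒≤ (<-trans ≤-refl x<m)) ⟩
      t + r + ∑ x (λ y → δ y (P (t + r)))           ≤⟨ +-monoʳ-≤ (t + r) trade ⟩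
      t + r + ∑ (suc x) (λ y → δ y (P t))           ≡⟨ shuffle t (∑ (suc x) (λ y → δ y (P t))) r ⟩
      t + ∑ (suc x) (λ y → δ y (P t)) + r           ≡⟨ cong (_+ r) (count t (suc x) (<⇒≤ x<m)) ⟨
      ∑ (t * m + suc x) unit + r                    ≡⟨ cong (λ y → ∑ y unit + r) k≡ ⟨
      ∑ k unit + r                                  ∎
      where
      -- If `v` occurs among the first `x` places of block `t + r`, then `P t ≤ x`, so its place in
      -- block `t` precedes the window.
      trade : ∑ x (λ y → δ y (P (t + r))) ≤ ∑ (suc x) (λ y → δ y (P t))
      trade with P t ≤? x
      ... | yes P≤x = ≤-trans (∑-δ-≤ x (P (t + r))) (≤-reflexive (sym (∑-δ (suc x) (s≤s P≤x))))
      ... | no P≰x  = ≤-trans (≤-reflexive (∑-zero x λ y y<x → δ-≢ {y} {P (t + r)} λ { refl →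
              P≰x (≤-trans (P-step t) y<x) })) z≤n

-- Arithmetic modulo an odd number

%-cong-+ : ∀ M .{{_ : NonZero M}} {a b} c → a % M ≡ b % M → (a + c) % M ≡ (b + c) % M
%-cong-+ M {a} {b} c eq = trans (%-distribˡ-+ a c M) (trans (cong (λ x → (x + c % M) % M) eq) (sym (%-distribˡ-+ b c M)))

partner : ∀ M .{{_ : NonZero M}} {a b} → a < M → b < M → ((a + b) % M + (M ∸ a)) % M ≡ b
partner M {a} {b} a<M b<M = begin
  ((a + b) % M + (M ∸ a)) % M ≡⟨ %-cong-+ M {(a + b) % M} {a + b} (M ∸ a) (m%n%n≡m%n (a + b) M) ⟩
  (a + b + (M ∸ a)) % M       ≡⟨ cong (_% M) (trans (lemma a b (M ∸ a)) (cong (b +_) (m+[n∸m]≡n (<⇒≤ a<M)))) ⟩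
  (b + M) % M                 ≡⟨ [m+n]%n≡m%n b M ⟩
  b % M                       ≡⟨ m<n⇒m%n≡m b<M ⟩
  b                           ∎
  where
  open ≡-Reasoning
  lemma : ∀ a b c → a + b + c ≡ b + (a + c)
  lemma = solve-∀

partner-unique : ∀ M .{{_ : NonZero M}} {a b c} → a < M → b < M → c < M → (a + b) % M ≡ (a + c) % M → b ≡ c
partner-unique M {a} a<M b<M c<M eq =
  trans (sym (partner M a<M b<M)) (trans (cong (λ x → (x + (M ∸ a)) % M) eq) (partner M a<M c<M))

-- The cyclic length of a difference `x` in ℤ/M.
fold : ℕ → ℕ → ℕ
fold M x = x ⊓ (M ∸ x)

fold-injective : ∀ M {x y} → x ≤ M → y ≤ M → fold M x ≡ fold M y → x ≡ y ⊎ x + y ≡ M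
fold-injective M {x} {y} x≤M y≤M eq with ⊓-sel x (M ∸ x) | ⊓-sel y (M ∸ y)
... | inj₁ p | inj₁ q = inj₁ (trans (sym p) (trans eq q))
... | inj₁ p | inj₂ q = inj₂ (trans (cong (_+ y) (trans (sym p) (trans eq q))) (m∸n+n≡m y≤M))
... | inj₂ p | inj₁ q = inj₂ (trans (cong (x +_) (trans (sym q) (trans (sym eq) p))) (m+[n∸m]≡n x≤M))
... | inj₂ p | inj₂ q = inj₁ (∸-cancelˡ-≡ x≤M y≤M (trans (sym p) (trans eq q)))

fold-0 : ∀ M x → fold M ∣ x - x ∣ ≡ 0
fold-0 M x rewrite ∣n-n∣≡0 x = refl

fold-≤ : ∀ h x → fold (suc (h + h)) x ≤ h
fold-≤ h x with x ≤? h
... | yes x≤h = ≤-trans (m⊓n≤m x _) x≤h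
... | no x≰h  = ≤-trans (m⊓n≤n x _) (≤-trans (∸-monoʳ-≤ (suc (h + h)) (≰⇒> x≰h)) (≤-reflexive (m+n∸n≡m h h)))

∸-suc-≤ : ∀ m n → m ∸ n ≤ suc (m ∸ suc n)
∸-suc-≤ zero    n       = ≤-trans (m∸n≤m 0 n) z≤n
∸-suc-≤ (suc m) zero    = ≤-refl
∸-suc-≤ (suc m) (suc n) = ∸-suc-≤ m n

∣-∣-suc : ∀ z y → ∣ z - suc y ∣ ≤ suc ∣ z - y ∣ × ∣ z - y ∣ ≤ suc ∣ z - suc y ∣
∣-∣-suc zero    y       = ≤-refl , ≤-trans (n≤1+n y) (n≤1+n (suc y))
∣-∣-suc (suc z) zero    = subst (λ a → a ≤ suc (suc z) × suc z ≤ suc a) (sym (∣-∣-identityʳ z))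
  (≤-trans (n≤1+n z) (n≤1+n (suc z)) , ≤-refl)
∣-∣-suc (suc z) (suc y) = ∣-∣-suc z y

-- A step on a cycle changes distances by at most one; at the wrap from `L − 1` to 0 the two arcs
-- between the points exchange roles.
fold-step : ∀ L .{{_ : NonZero L}} z y → z < L → y < L →
  fold L ∣ z - suc y % L ∣ ≤ suc (fold L ∣ z - y ∣)
fold-step L z y z<L y<L with m≤n⇒m<n∨m≡n y<L
... | inj₁ sy<L rewrite m<n⇒m%n≡m sy<L = ⊓-glb
  (≤-trans (m⊓n≤m _ _) (proj₁ (∣-∣-suc z y)))
  (≤-trans (m⊓n≤n _ _) (≤-trans (∸-suc-≤ L ∣ z - suc y ∣) (s≤s (∸-monoʳ-≤ L (proj₂ (∣-∣-suc z y))))))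
... | inj₂ refl rewrite n%n≡0 (suc y) {{_}} | ∣-∣-identityʳ z | m≤n⇒∣m-n∣≡n∸m (s≤s⁻¹ z<L) = ⊓-glb
  (≤-trans (m⊓n≤n z _) (≤-reflexive (+-∸-assoc 1 (s≤s⁻¹ z<L))))
  (≤-trans (m⊓n≤m z _) (≤-trans (≤-reflexive (sym (m∸[m∸n]≡n (s≤s⁻¹ z<L))))
    (≤-trans (∸-monoˡ-≤ (y ∸ z) (n≤1+n y)) (n≤1+n _))))

module OddModulus (h : ℕ) where

  M : ℕ
  M = suc (h + h)

  double-injective : ∀ {a b} → a < M → b < M → (a + a) % M ≡ (b + b) % M → a ≡ b
  double-injective {a} {b} a<M b<M eq = trans (sym (halve a a<M)) (trans (cong (λ x → (x * suc h) % M) eq) (halve b b<M))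
    where
    open ≡-Reasoning
    lemma : ∀ a h → (a + a) * suc h ≡ a + a * suc (h + h)
    lemma = solve-∀
    -- `suc h` is the inverse of 2 modulo `M`.
    halve : ∀ a → a < M → ((a + a) % M * suc h) % M ≡ a
    halve a a<M = begin
      ((a + a) % M * suc h) % M             ≡⟨ %-distribˡ-* ((a + a) % M) (suc h) M ⟩
      ((a + a) % M % M * (suc h % M)) % M   ≡⟨ cong (λ x → (x * (suc h % M)) % M) (m%n%n≡m%n (a + a) M) ⟩
      ((a + a) % M * (suc h % M)) % M       ≡⟨ %-distribˡ-* (a + a) (suc h) M ⟨
      ((a + a) * suc h) % M                 ≡⟨ cong (_% M) (lemma a h) ⟩
      (a + a * M) % M                       ≡⟨ [m+kn]%n≡m%n a a M ⟩
      a % M                                 ≡⟨ m<n⇒m%n≡m a<M ⟩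
      a                                     ∎

  -- Adding `x * (h + h)` subtracts `x` modulo `M`.
  %-cancel : ∀ {a b} x → (a + x) % M ≡ (b + x) % M → a % M ≡ b % M
  %-cancel {a} {b} x eq = begin
    a % M                      ≡⟨ [m+kn]%n≡m%n a x M ⟨
    (a + x * M) % M            ≡⟨ cong (_% M) (lemma a x h) ⟩
    (a + x + x * (h + h)) % M  ≡⟨ %-cong-+ M {a + x} {b + x} (x * (h + h)) eq ⟩
    (b + x + x * (h + h)) % M  ≡⟨ cong (_% M) (lemma b x h) ⟨
    (b + x * M) % M            ≡⟨ [m+kn]%n≡m%n b x M ⟩
    b % M                      ∎
    where
    open ≡-Reasoning
    lemma : ∀ a x h → a + x * suc (h + h) ≡ a + x + x * (h + h)
    lemma = solve-∀

  -- Equal differences give `2a ≡ 2c`. Complementary ones, `x + y = M`, give `2b ≡ 2c`, so `b = c`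
  -- and `d = a + M` would be too large.
  ordered-pair-unique : ∀ {a b c d} → a ≤ b → c ≤ d → b < M → d < M → (a + b) % M ≡ (c + d) % M →
    fold M ∣ a - b ∣ ≡ fold M ∣ c - d ∣ → a ≡ c × b ≡ d
  ordered-pair-unique {a} {_} {c} {_} a≤b c≤d b<M d<M sums folds
    with x , refl ← m≤n⇒∃[o]m+o≡n a≤b | y , refl ← m≤n⇒∃[o]m+o≡n c≤d
    with fold-injective M {x} {y} (<⇒≤ (≤-trans (s≤s (m≤n+m x a)) b<M)) (<⇒≤ (≤-trans (s≤s (m≤n+m y c)) d<M))
           (subst₂ (λ p q → fold M p ≡ fold M q) (∣m-m+n∣≡n a x) (∣m-m+n∣≡n c y) folds)
  ... | inj₁ refl = a≡c , cong (_+ x) a≡c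
    where
    a≡c : a ≡ c
    a≡c = double-injective (≤-trans (s≤s a≤b) b<M) (≤-trans (s≤s c≤d) d<M)
      (%-cancel {a + a} {c + c} x (subst₂ (λ p q → p % M ≡ q % M) (sym (+-assoc a a x)) (sym (+-assoc c c x)) sums))
  ... | inj₂ x+y≡M = contradiction d<M (≤⇒≯ (subst (_≤ c + y) x+y≡M (≤-trans (m≤n+m (x + y) a) (≤-reflexive (trans (sym (+-assoc a x y)) (cong (_+ y) b≡c))))))
    where
    open ≡-Reasoning
    l₁ : ∀ a x → a + x + (a + x) ≡ a + (a + x) + x
    l₁ = solve-∀
    l₂ : ∀ c x y → c + (c + y) + x ≡ c + c + (x + y)
    l₂ = solve-∀
    b≡c : a + x ≡ c
    b≡c = double-injective b<M (≤-trans (s≤s c≤d) d<M) (begin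
      (a + x + (a + x)) % M     ≡⟨ cong (_% M) (l₁ a x) ⟩
      (a + (a + x) + x) % M     ≡⟨ %-cong-+ M {a + (a + x)} {c + (c + y)} x sums ⟩
      (c + (c + y) + x) % M     ≡⟨ cong (_% M) (trans (l₂ c x y) (cong (c + c +_) x+y≡M)) ⟩
      (c + c + M) % M           ≡⟨ [m+n]%n≡m%n (c + c) M ⟩
      (c + c) % M               ∎)

  pair-unique : ∀ {a b c d} → a < M → b < M → c < M → d < M → (a + b) % M ≡ (c + d) % M →
    fold M ∣ a - b ∣ ≡ fold M ∣ c - d ∣ → (a ≡ c × b ≡ d) ⊎ (a ≡ d × b ≡ c)
  pair-unique {a} {b} {c} {d} a< b< c< d< sums folds with ≤-total a b | ≤-total c d
  ... | inj₁ a≤b | inj₁ c≤d = inj₁ (ordered-pair-unique a≤b c≤d b< d< sums folds)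
  ... | inj₁ a≤b | inj₂ d≤c = inj₂ (ordered-pair-unique a≤b d≤c b< c< (trans sums (cong (_% M) (+-comm c d)))
    (trans folds (cong (fold M) (∣-∣-comm c d))))
  ... | inj₂ b≤a | inj₁ c≤d = let p , q = ordered-pair-unique b≤a c≤d a< d< (trans (cong (_% M) (+-comm b a)) sums)
                                            (trans (cong (fold M) (∣-∣-comm b a)) folds) in inj₂ (q , p)
  ... | inj₂ b≤a | inj₂ d≤c = let p , q = ordered-pair-unique b≤a d≤c a< c<
                                            (trans (cong (_% M) (+-comm b a)) (trans sums (cong (_% M) (+-comm c d))))
                                            (trans (cong (fold M) (∣-∣-comm b a)) (trans folds (cong (fold M) (∣-∣-comm c d))))
                              in inj₁ (q , p)

-- Even n

-- K_n has vertices ∞ = 0 and suc b, where b stands for the point (b % g , b / g) of ℤ/g × ℤ/L.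
-- The edge between two points is coloured by their sum, the edge from ∞ to b like the
-- degenerate pair {b , b}, so that each colour class is a perfect matching. In the union of the
-- classes (i , s) and (i , s − 1), edges between fibres w ≠ w′ form cycles, along which the
-- z-coordinate of the end in the smaller of the two fibres serves as offset; edges inside a fibre
-- together with ∞ form a cycle along which the cyclic distance of the z-coordinates does.
-- From s to s − 1 the offset at a vertex drops by at most one, and the time of a colour is
-- chosen so that s decreases by one every r = r′ g blocks.
module EvenOrder (g′ L′ r′ u c : ℕ) (bezout : 1 + r′ * u ≡ c * suc (L′ + L′)) (1≤r′ : 1 ≤ r′) where

  g L N m n r E : ℕ
  g = suc (g′ + g′)
  L = suc (L′ + L′)
  N = L * g
  m = g′ * L + suc L′
  n = suc N
  r = r′ * g
  E = N * m

  module Modg = OddModulus g′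
  module ModL = OddModulus L′

  instance
    m≢0 : NonZero m
    m≢0 = >-nonZero (≤-trans z<s (m≤n+m (suc L′) (g′ * L)))
    E≢0 : NonZero E
    E≢0 = m*n≢0 N m

  -- The block of colour (i , s), with quotient -r′s and remainder `i` on division by `g`; `L′ + L′`
  -- stands for -1 modulo `L`. Since r′u ≡ -1, multiplying the quotient by `u` gives back `s`, which
  -- is `sumAt`.
  time : ℕ → ℕ → ℕ
  time i s = (r′ * (L′ + L′) * s) % L * g + i

  sumAt : ℕ → ℕ
  sumAt t = (t / g * u) % L

  time< : ∀ i s → i < g → time i s < N
  time< i s i<g = ≤-trans (+-monoʳ-< (y * g) i<g)
    (≤-trans (≤-reflexive (+-comm (y * g) g)) (*-monoˡ-≤ g (m%n<n (r′ * (L′ + L′) * s) L)))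
    where y = (r′ * (L′ + L′) * s) % L

  %-*-% : ∀ a b → (a % L * b) % L ≡ (a * b) % L
  %-*-% a b = trans (%-distribˡ-* (a % L) b L)
    (trans (cong (λ x → (x * (b % L)) % L) (m%n%n≡m%n a L)) (sym (%-distribˡ-* a b L)))

  sumAt-time : ∀ i s → i < g → s < L → sumAt (time i s) ≡ s
  sumAt-time i s i<g s<L = begin
    (time i s / g * u) % L               ≡⟨ cong (λ y → (y * u) % L) (block-/ g ((r′ * (L′ + L′) * s) % L) i<g) ⟩
    ((r′ * (L′ + L′) * s) % L * u) % L   ≡⟨ %-*-% (r′ * (L′ + L′) * s) u ⟩
    (r′ * (L′ + L′) * s * u) % L         ≡⟨ [m+kn]%n≡m%n (r′ * (L′ + L′) * s * u) s L ⟨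
    (r′ * (L′ + L′) * s * u + s * L) % L ≡⟨ cong (_% L) eq ⟩
    (s + (L′ + L′) * s * c * L) % L      ≡⟨ [m+kn]%n≡m%n s ((L′ + L′) * s * c) L ⟩
    s % L                                ≡⟨ m<n⇒m%n≡m s<L ⟩
    s                                    ∎
    where
    open ≡-Reasoning
    l₁ : ∀ r l s u → r * l * s * u + s * suc l ≡ s + l * s * (1 + r * u)
    l₁ = solve-∀
    eq : r′ * (L′ + L′) * s * u + s * L ≡ s + (L′ + L′) * s * c * L
    eq = trans (l₁ r′ (L′ + L′) s u) (cong (s +_) (trans (cong ((L′ + L′) * s *_) bezout) (sym (*-assoc ((L′ + L′) * s) c L))))

  -- After `r` blocks `t / g` has grown by `r′`, and r′u ≡ -1 modulo `L`.
  sumAt-step : ∀ t → sumAt t ≡ suc (sumAt (t + r)) % L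
  sumAt-step t = sym (begin
    suc ((t + r) / g * u % L) % L         ≡⟨ cong (_% L) (+-comm 1 _) ⟩
    ((t + r) / g * u % L + 1) % L         ≡⟨ %-cong-+ L {(t + r) / g * u % L} {(t + r) / g * u} 1 (m%n%n≡m%n ((t + r) / g * u) L) ⟩
    ((t + r) / g * u + 1) % L             ≡⟨ cong (λ y → (y * u + 1) % L) (trans (+-distrib-/-∣ʳ t (n∣m*n r′)) (cong (t / g +_) (m*n/n≡m r′ g))) ⟩
    ((t / g + r′) * u + 1) % L            ≡⟨ cong (_% L) (trans (lemma (t / g) r′ u) (cong (t / g * u +_) bezout)) ⟩
    (t / g * u + c * L) % L               ≡⟨ [m+kn]%n≡m%n (t / g * u) c L ⟩
    (t / g * u) % L                       ∎)
    where
    open ≡-Reasoning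
    lemma : ∀ y r u → (y + r) * u + 1 ≡ y * u + (1 + r * u)
    lemma = solve-∀

  sumAt-% : ∀ t → sumAt (t % N) ≡ sumAt t
  sumAt-% t = trans (cong (λ y → (y * u) % L) (m%[n*o]/o≡m/o%n t L g)) (%-*-% (t / g) u)

  inner : ℕ → ℕ → ℕ → ℕ → ℕ
  inner w z w′ z′ = if w <ᵇ w′ then z else if w′ <ᵇ w then z′ else fold L ∣ z - z′ ∣

  inner-< : ∀ {w z w′ z′} → w < w′ → inner w z w′ z′ ≡ z
  inner-< w<w′ rewrite <ᵇ-true w<w′ = refl

  inner-> : ∀ {w z w′ z′} → w′ < w → inner w z w′ z′ ≡ z′
  inner-> w>w′ rewrite <ᵇ-false (<⇒≤ w>w′) | <ᵇ-true w>w′ = refl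

  inner-≡ : ∀ w {z z′} → inner w z w z′ ≡ fold L ∣ z - z′ ∣
  inner-≡ w rewrite <ᵇ-false (≤-refl {w}) = refl

  inner-sym : ∀ w z w′ z′ → inner w z w′ z′ ≡ inner w′ z′ w z
  inner-sym w z w′ z′ with <-cmp w w′
  ... | tri< w<w′ _ _ = trans (inner-< w<w′) (sym (inner-> w<w′))
  ... | tri> _ _ w>w′ = trans (inner-> w>w′) (sym (inner-< w>w′))
  ... | tri≈ _ refl _ = trans (inner-≡ w) (trans (cong (fold L) (∣-∣-comm z z′)) (sym (inner-≡ w)))

  inner-bound : ∀ {w z w′ z′} → z < L → z′ < L → inner w z w′ z′ < L
  inner-bound {w} {z} {w′} {z′} z<L z′<L with <-cmp w w′
  ... | tri< w<w′ _ _ = subst (_< L) (sym (inner-< w<w′)) z<L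
  ... | tri> _ _ w>w′ = subst (_< L) (sym (inner-> w>w′)) z′<L
  ... | tri≈ _ refl _ = subst (_< L) (sym (inner-≡ w)) (s≤s (≤-trans (fold-≤ L′ ∣ z - z′ ∣) (m≤m+n L′ L′)))

  -- The offset is the fixed `z`, or the moving coordinate, which the wrap to 0 only lowers, or a
  -- distance that changes by at most one.
  inner-step : ∀ {w z w′ y} → z < L → y < L → inner w z w′ (suc y % L) ≤ suc (inner w z w′ y)
  inner-step {w} {z} {w′} {y} z<L y<L with <-cmp w w′
  ... | tri< w<w′ _ _ = subst₂ (λ a b → a ≤ suc b) (sym (inner-< w<w′)) (sym (inner-< w<w′)) (n≤1+n z)
  ... | tri> _ _ w>w′ = subst₂ (λ a b → a ≤ suc b) (sym (inner-> w>w′)) (sym (inner-> w>w′)) (m%n≤m (suc y) L)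
  ... | tri≈ _ refl _ = subst₂ (λ a b → a ≤ suc b) (sym (inner-≡ w)) (sym (inner-≡ w)) (fold-step L z y z<L y<L)

  -- For each distance between fibres a block has a segment of `L` places. Distances are taken in
  -- decreasing order, so that the shorter segment of distance 0, with `L′ + 1` places, comes last
  -- and `inner` stays a digit in base `L`.
  offset : ℕ → ℕ → ℕ → ℕ → ℕ
  offset w z w′ z′ = (g′ ∸ fold g ∣ w - w′ ∣) * L + inner w z w′ z′

  offset-sym : ∀ w z w′ z′ → offset w z w′ z′ ≡ offset w′ z′ w z
  offset-sym w z w′ z′ = cong₂ (λ d i → (g′ ∸ fold g d) * L + i) (∣-∣-comm w w′) (inner-sym w z w′ z′)

  offset-diagonal : ∀ w z → offset w z w z ≡ g′ * L
  offset-diagonal w z = trans (cong₂ (λ d i → (g′ ∸ d) * L + i) (fold-0 g w) (trans (inner-≡ w) (fold-0 L z))) (+-identityʳ _)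

  offset-bound : ∀ {w z w′ z′} → w < g → w′ < g → z < L → z′ < L → offset w z w′ z′ < m
  offset-bound {w} {z} {w′} {z′} w<g w′<g z<L z′<L with w ≟ w′
  ... | yes refl = +-mono-≤-< (*-monoˡ-≤ L (m∸n≤m g′ (fold g ∣ w - w ∣)))
    (s≤s (subst (_≤ L′) (sym (inner-≡ w)) (fold-≤ L′ ∣ z - z′ ∣)))
  ... | no w≢w′ = begin-strict
    (g′ ∸ D) * L + inner w z w′ z′ <⟨ +-monoʳ-< ((g′ ∸ D) * L) (inner-bound {w} {z} {w′} {z′} z<L z′<L) ⟩
    (g′ ∸ D) * L + L               ≡⟨ +-comm _ L ⟩
    suc (g′ ∸ D) * L               ≤⟨ *-monoˡ-≤ L (∸-monoʳ-< 0<D (fold-≤ g′ ∣ w - w′ ∣)) ⟩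
    g′ * L                         ≤⟨ m≤m+n (g′ * L) (suc L′) ⟩
    m                              ∎
    where
    open ≤-Reasoning
    D = fold g ∣ w - w′ ∣
    0<D : 0 < D
    0<D = ⊓-glb (n≢0⇒n>0 (w≢w′ ∘ ∣m-n∣≡0⇒m≡n))
      (m<n⇒0<n∸m (≤-<-trans (∣m-n∣≤m⊔n w w′) (⊔-lub w<g w′<g)))

  -- Between different fibres `inner` names one end and the sum gives the other; within a fibre, sum
  -- and distance fix the pair up to order.
  same-fibre : ∀ {w w′ z₁ z₂ y₁ y₂} → z₁ < L → z₂ < L → y₁ < L → y₂ < L → (z₁ + z₂) % L ≡ (y₁ + y₂) % L →
    inner w z₁ w′ z₂ ≡ inner w y₁ w′ y₂ → (z₁ ≡ y₁ × z₂ ≡ y₂) ⊎ (w ≡ w′ × z₁ ≡ y₂ × z₂ ≡ y₁)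
  same-fibre {w} {w′} {z₁} {z₂} {y₁} {y₂} z₁< z₂< y₁< y₂< sums inners with <-cmp w w′
  ... | tri< w<w′ _ _ with refl ← trans (sym (inner-< w<w′)) (trans inners (inner-< w<w′)) =
    inj₁ (refl , partner-unique L z₁< z₂< y₂< sums)
  ... | tri> _ _ w>w′ with refl ← trans (sym (inner-> {w} {z₁} w>w′)) (trans inners (inner-> {w} {y₁} w>w′)) =
    inj₁ (partner-unique L z₂< z₁< y₁< (subst₂ (λ a b → a % L ≡ b % L) (+-comm z₁ z₂) (+-comm y₁ z₂) sums) , refl)
  ... | tri≈ _ refl _ with ModL.pair-unique z₁< z₂< y₁< y₂< sums (trans (sym (inner-≡ w)) (trans inners (inner-≡ w)))
  ...   | inj₁ same    = inj₁ same
  ...   | inj₂ swapped = inj₂ (refl , swapped)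

  rest : ∀ b → b < N → b / g < L
  rest b b<N = m<n*o⇒m/o<n b<N

  point-≡ : ∀ {b b′} → b % g ≡ b′ % g → b / g ≡ b′ / g → b ≡ b′
  point-≡ {b} {b′} p q = trans (m≡m%n+[m/n]*n b g) (trans (cong₂ (λ x y → x + y * g) p q) (sym (m≡m%n+[m/n]*n b′ g)))

  colour₁ colour₂ pairTime pairOffset pairLabel : ℕ → ℕ → ℕ
  colour₁ a b    = (a % g + b % g) % g
  colour₂ a b    = (a / g + b / g) % L
  pairTime a b   = time (colour₁ a b) (colour₂ a b)
  pairOffset a b = offset (a % g) (a / g) (b % g) (b / g)
  pairLabel a b  = pairTime a b * m + pairOffset a b

  pairOffset< : ∀ a b → a < N → b < N → pairOffset a b < m
  pairOffset< a b a<N b<N = offset-bound (m%n<n a g) (m%n<n b g) (rest a a<N) (rest b b<N)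

  pairTime< : ∀ a b → pairTime a b < N
  pairTime< a b = time< (colour₁ a b) (colour₂ a b) (m%n<n (a % g + b % g) g)

  pairLabel< : ∀ a b → a < N → b < N → pairLabel a b < E
  pairLabel< a b a<N b<N = ≤-trans (+-monoʳ-< (pairTime a b * m) (pairOffset< a b a<N b<N))
    (≤-trans (≤-reflexive (+-comm _ m)) (*-monoˡ-≤ m (pairTime< a b)))

  timeColour₁ : ∀ a b → pairTime a b % g ≡ colour₁ a b
  timeColour₁ a b = block-% g ((r′ * (L′ + L′) * colour₂ a b) % L) (m%n<n (a % g + b % g) g)

  timeColour₂ : ∀ a b → sumAt (pairTime a b) ≡ colour₂ a b
  timeColour₂ a b = sumAt-time (colour₁ a b) (colour₂ a b) (m%n<n (a % g + b % g) g) (m%n<n (a / g + b / g) L)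

  -- The label is read digit by digit: the block gives both sums, the offset gives the distance of
  -- the fibres and `inner`. Sum and distance fix the fibres up to order, and `same-fibre` does the
  -- rest.
  pairLabel-injective : ∀ {a b a′ b′} → a < N → b < N → a′ < N → b′ < N → pairLabel a b ≡ pairLabel a′ b′ →
    (a ≡ a′ × b ≡ b′) ⊎ (a ≡ b′ × b ≡ a′)
  pairLabel-injective {a} {b} {a′} {b′} a< b< a′< b′< eq
    with times , offsets ← block-injective m {pairTime a b} {pairTime a′ b′} (pairOffset< a b a< b<) (pairOffset< a′ b′ a′< b′<) eq
    with Ds , inners ← block-injective L {x = inner (a % g) (a / g) (b % g) (b / g)}
           (inner-bound {a % g} {a / g} {b % g} {b / g} (rest a a<) (rest b b<))
           (inner-bound {a′ % g} {a′ / g} {b′ % g} {b′ / g} (rest a′ a′<) (rest b′ b′<)) offsets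
    with sums₁ ← trans (sym (timeColour₁ a b)) (trans (cong (_% g) times) (timeColour₁ a′ b′))
       | sums₂ ← trans (sym (timeColour₂ a b)) (trans (cong sumAt times) (timeColour₂ a′ b′))
    with Modg.pair-unique (m%n<n a g) (m%n<n b g) (m%n<n a′ g) (m%n<n b′ g) sums₁
           (∸-cancelˡ-≡ (fold-≤ g′ ∣ a % g - b % g ∣) (fold-≤ g′ ∣ a′ % g - b′ % g ∣) Ds)
  ... | inj₁ (p , q)
    with same-fibre {a % g} {b % g} (rest a a<) (rest b b<) (rest a′ a′<) (rest b′ b′<) sums₂
           (trans inners (cong₂ (λ x y → inner x (a′ / g) y (b′ / g)) (sym p) (sym q)))
  ...   | inj₁ (s , t)      = inj₁ (point-≡ p s , point-≡ q t)
  ...   | inj₂ (w≡ , s , t) = inj₂ (point-≡ (trans w≡ q) s , point-≡ (trans (sym w≡) p) t)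
  pairLabel-injective {a} {b} {a′} {b′} a< b< a′< b′< eq | inj₂ (p , q)
    with same-fibre {a % g} {b % g} (rest a a<) (rest b b<) (rest b′ b′<) (rest a′ a′<)
           (trans sums₂ (cong (_% L) (+-comm (a′ / g) (b′ / g))))
           (trans inners (trans (inner-sym (a′ % g) (a′ / g) (b′ % g) (b′ / g)) (cong₂ (λ x y → inner x (b′ / g) y (a′ / g)) (sym p) (sym q))))
  ...   | inj₁ (s , t)      = inj₂ (point-≡ p s , point-≡ q t)
  ...   | inj₂ (w≡ , s , t) = inj₁ (point-≡ (trans w≡ q) s , point-≡ (trans (sym w≡) p) t)

  -- The place of a vertex in block `t`: its partner is the colour minus the vertex. A vertex that
  -- is its own partner is matched to ∞, at the constant place `g′ * L`.
  P : ℕ → ℕ → ℕ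
  P zero    t = g′ * L
  P (suc a) t = offset (a % g) (a / g) ((t % g + (g ∸ a % g)) % g) ((sumAt t + (L ∸ a / g)) % L)

  P< : ∀ v → v < n → ∀ t → P v t < m
  P< zero    _         t = subst (_< m) (+-identityʳ (g′ * L)) (+-monoʳ-< (g′ * L) z<s)
  P< (suc a) (s<s a<N) t = offset-bound (m%n<n a g) (m%n<n (t % g + (g ∸ a % g)) g) (rest a a<N) (m%n<n (sumAt t + (L ∸ a / g)) L)

  -- From `t` to `t + r` the partner stays in its fibre, hence the edge in its segment, while the
  -- z-coordinate of the partner drops by one cyclically.
  P-step : ∀ v → v < n → ∀ t → P v t ≤ suc (P v (t + r))
  P-step zero    _         t = n≤1+n (g′ * L)
  P-step (suc a) (s<s a<N) t = begin
    D w₁ * L + inner (a % g) (a / g) w₁ (Z t)              ≡⟨ cong₂ (λ x y → D x * L + inner (a % g) (a / g) x y) w≡ z≡ ⟩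
    D w₂ * L + inner (a % g) (a / g) w₂ (suc (Z (t + r)) % L)
      ≤⟨ +-monoʳ-≤ (D w₂ * L) (inner-step {a % g} {a / g} {w₂} (rest a a<N) (m%n<n (sumAt (t + r) + (L ∸ a / g)) L)) ⟩
    D w₂ * L + suc (inner (a % g) (a / g) w₂ (Z (t + r)))  ≡⟨ +-suc (D w₂ * L) _ ⟩
    suc (P (suc a) (t + r))                                ∎
    where
    open ≤-Reasoning
    D Z : ℕ → ℕ
    D w = g′ ∸ fold g ∣ a % g - w ∣
    Z t = (sumAt t + (L ∸ a / g)) % L
    w₁ = (t % g + (g ∸ a % g)) % g
    w₂ = ((t + r) % g + (g ∸ a % g)) % g
    w≡ : w₁ ≡ w₂
    w≡ = cong (λ x → (x + (g ∸ a % g)) % g) (sym ([m+kn]%n≡m%n t r′ g))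
    k = L ∸ a / g
    z≡ : Z t ≡ suc (Z (t + r)) % L
    z≡ = begin-equality
      (sumAt t + k) % L                    ≡⟨ cong (λ x → (x + k) % L) (sumAt-step t) ⟩
      (suc (sumAt (t + r)) % L + k) % L    ≡⟨ %-cong-+ L {suc (sumAt (t + r)) % L} {suc (sumAt (t + r))} k (m%n%n≡m%n (suc (sumAt (t + r))) L) ⟩
      suc (sumAt (t + r) + k) % L          ≡⟨ cong (_% L) (+-comm 1 (sumAt (t + r) + k)) ⟩
      (sumAt (t + r) + k + 1) % L          ≡⟨ %-cong-+ L {(sumAt (t + r) + k) % L} {sumAt (t + r) + k} 1 (m%n%n≡m%n (sumAt (t + r) + k) L) ⟨
      (Z (t + r) + 1) % L                  ≡⟨ cong (_% L) (+-comm (Z (t + r)) 1) ⟩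
      suc (Z (t + r)) % L                  ∎

  P-% : ∀ v t → P v (t % N) ≡ P v t
  P-% zero    t = refl
  P-% (suc a) t = cong₂ (λ x y → offset (a % g) (a / g) ((x + (g ∸ a % g)) % g) ((y + (L ∸ a / g)) % L))
    (m∣n⇒o%n%m≡o%m g N t (n∣m*n L)) (sumAt-% t)

  P-left : ∀ a b → a < N → b < N → P (suc a) (pairTime a b) ≡ pairOffset a b
  P-left a b a<N b<N = cong₂ (offset (a % g) (a / g))
    (trans (cong (λ x → (x + (g ∸ a % g)) % g) (timeColour₁ a b)) (partner g (m%n<n a g) (m%n<n b g)))
    (trans (cong (λ x → (x + (L ∸ a / g)) % L) (timeColour₂ a b)) (partner L (rest a a<N) (rest b b<N)))

  pairTime-sym : ∀ a b → pairTime a b ≡ pairTime b a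
  pairTime-sym a b = cong₂ time (cong (_% g) (+-comm (a % g) (b % g))) (cong (_% L) (+-comm (a / g) (b / g)))

  P-right : ∀ a b → a < N → b < N → P (suc b) (pairTime a b) ≡ pairOffset a b
  P-right a b a<N b<N = trans (cong (P (suc b)) (pairTime-sym a b))
    (trans (P-left b a b<N a<N) (offset-sym (b % g) (b / g) (a % g) (a / g)))

  -- An edge from ∞ to `suc b` becomes {b , b}; so `lo` and `hi` coincide exactly on the edges at ∞.
  lower : ℕ → ℕ → ℕ
  lower zero    j = pred j
  lower (suc i) j = i

  lower≤ : ∀ i j → i < j → lower i j ≤ pred j
  lower≤ zero    j       _       = ≤-refl
  lower≤ (suc i) (suc j) (s<s p) = <⇒≤ p

  lower-injective : ∀ i j i′ j′ → i < j → i′ < j′ → lower i j ≡ lower i′ j′ → pred j ≡ pred j′ → i ≡ i′ × j ≡ j′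
  lower-injective zero    (suc j) zero     (suc j′) _ _ _ eq = refl , cong suc eq
  lower-injective (suc i) (suc j) (suc i′) (suc j′) _ _ p eq = cong suc p , cong suc eq
  lower-injective zero    (suc j) (suc i′) (suc j′) _ (s<s lt) p eq = contradiction (trans (sym p) eq) (<⇒≢ lt)
  lower-injective (suc i) (suc j) zero     (suc j′) (s<s lt) _ p eq = contradiction (trans p (sym eq)) (<⇒≢ lt)

  lo hi : Edge n → ℕ
  lo (i , j , _) = lower (toℕ i) (toℕ j)
  hi (i , j , _) = pred (toℕ j)

  hi<N : ∀ e → hi e < N
  hi<N (i , j , i<j) = go (toℕ j) i<j (toℕ<n j)
    where
    go : ∀ j → toℕ i < j → j < n → pred j < N
    go (suc j) _ (s<s lt) = lt

  lo≤hi : ∀ e → lo e ≤ hi e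
  lo≤hi (i , j , i<j) = lower≤ (toℕ i) (toℕ j) i<j

  lo<N : ∀ e → lo e < N
  lo<N e = ≤-<-trans (lo≤hi e) (hi<N e)

  label : Edge n → ℕ
  label e = pairLabel (lo e) (hi e)

  label-injective : ∀ {e e′} → label e ≡ label e′ → e ≡ e′
  label-injective {e@(i , j , i<j)} {e′@(i′ , j′ , i′<j′)} eq
    with pairLabel-injective (lo<N e) (hi<N e) (lo<N e′) (hi<N e′) eq
  ... | inj₁ (p , q) = let i≡ , j≡ = lower-injective (toℕ i) (toℕ j) (toℕ i′) (toℕ j′) i<j i′<j′ p q
                       in edge-≡ (toℕ-injective i≡) (toℕ-injective j≡)
  ... | inj₂ (p , q) = let i≡ , j≡ = lower-injective (toℕ i) (toℕ j) (toℕ i′) (toℕ j′) i<j i′<j′ (trans p hi′≡lo′) (trans q (sym hi′≡lo′))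
                       in edge-≡ (toℕ-injective i≡) (toℕ-injective j≡)
    where
    -- As `lo ≤ hi` for both edges, a crossed match forces degenerate pairs, where crossing is
    -- harmless.
    hi′≡lo′ : hi e′ ≡ lo e′
    hi′≡lo′ = ≤-antisym (subst₂ _≤_ p q (lo≤hi e)) (lo≤hi e′)

  inc⇒P : ∀ v e → inc v e ≢ 0 → P v (pairTime (lo e) (hi e)) ≡ pairOffset (lo e) (hi e)
  inc⇒P v e@(i , j , i<j) ne = go (toℕ i) (toℕ j) i<j (toℕ<n j) (inc⇒endpoint v e ne)
    where
    go : ∀ i j → i < j → j < n → v ≡ i ⊎ v ≡ j →
      P v (pairTime (lower i j) (pred j)) ≡ pairOffset (lower i j) (pred j)
    go zero    (suc b) _ _ (inj₁ refl)                = sym (offset-diagonal (b % g) (b / g))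
    go zero    (suc b) _ (s<s b<N) (inj₂ refl)        = P-left b b b<N b<N
    go (suc a) (suc b) (s<s a<b) (s<s b<N) (inj₁ refl) = P-left a b (<-trans a<b b<N) b<N
    go (suc a) (suc b) (s<s a<b) (s<s b<N) (inj₂ refl) = P-right a b (<-trans a<b b<N) b<N

  inc≤1 : ∀ v (e : Edge n) → inc v e ≤ 1
  inc≤1 v (i , j , i<j) = δ-disjoint v (<⇒≢ i<j)

  numEdges≡E : numEdges n ≡ E
  numEdges≡E = numEdges-unique N (trans (l₁ N m) (cong (_* N) (sym n≡2m)))
    where
    l₁ : ∀ N m → 2 * (N * m) ≡ 2 * m * N
    l₁ = solve-∀
    l₂ : ∀ g L → suc (suc (L + L) * suc (g + g)) ≡ 2 * (g * suc (L + L) + suc L)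
    l₂ = solve-∀
    n≡2m : n ≡ 2 * m
    n≡2m = l₂ g′ L′

  cms-even : 3 ≤ n → r ≤ n ∸ 2 → IsCmsComplete n r ((r * n ∸ 1) / 2)
  cms-even 3≤n r≤ with r * m in rm≡
  ... | zero = contradiction rm≡ (m<n⇒n≢0 (*-mono-≤ 1≤r (≤-trans z<s (m≤n+m (suc L′) (g′ * L)))))
    where
    1≤r : 1 ≤ r
    1≤r = *-mono-≤ 1≤r′ z<s
  ... | suc s = cms-from-labelling n r s E numEdges≡E 3≤n (*-mono-≤ 1≤r′ z<s) r≤ s≡ s≤E
    label (λ e → pairLabel< (lo e) (hi e) (lo<N e) (hi<N e)) label-injective
    windows
    where
    l₁ : ∀ g L r → r * suc (suc (L + L) * suc (g + g)) ≡ r * (g * suc (L + L) + suc L) + r * (g * suc (L + L) + suc L)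
    l₁ = solve-∀
    s≡ : (r * n ∸ 1) / 2 ≡ s
    s≡ = trans (cong (λ x → (x ∸ 1) / 2) (trans (l₁ g′ L′ r) (cong₂ _+_ rm≡ rm≡))) (halve-odd s)
    s≤E : s ≤ E
    s≤E = ≤-trans (n≤1+n s) (≤-trans (≤-reflexive (sym rm≡)) (*-monoˡ-≤ m (≤-trans r≤ (m∸n≤m N 1))))
    windows : ∀ v (edge : ℕ → Edge n) → (∀ x → label (edge x) ≡ x % E) →
      ∀ k → k < E → ∑ s (λ i → inc v (edge (k + i))) ≤ r
    windows v edge label≡ k _ with v <? n
    ... | no v≮n = ≤-trans (≤-reflexive (∑-zero s λ i _ → outside (edge (k + i)))) z≤n
      where
      outside : ∀ (e : Edge n) → inc v e ≡ 0
      outside (i , j , _) = cong₂ _+_ (δ-≢ {v} {toℕ i} λ { refl → v≮n (toℕ<n i) }) (δ-≢ {v} {toℕ j} λ { refl → v≮n (toℕ<n j) })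
    ... | yes v<n = blocks-bound m r s (P v) rm≡ (P< v v<n) (P-step v v<n) (λ x → inc v (edge x)) unit k
      where
      unit : ∀ t x → x < m → inc v (edge (t * m + x)) ≤ δ x (P v t)
      unit t x x<m with inc v (edge (t * m + x)) ≟ 0
      ... | yes eq = ≤-trans (≤-reflexive eq) z≤n
      ... | no ne = ≤-trans (inc≤1 v e) (≤-reflexive (sym (trans (cong (λ y → δ y (P v t)) x≡) (δ-refl (P v t)))))
        where
        e = edge (t * m + x)
        -- Labels are positions modulo `E = N * m`, so quotient and remainder by `m` are the block
        -- modulo `N` and the offset.
        coordinates : pairTime (lo e) (hi e) ≡ t % N × pairOffset (lo e) (hi e) ≡ x
        coordinates = block-injective m (pairOffset< (lo e) (hi e) (lo<N e) (hi<N e)) x<m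
          (trans (label≡ (t * m + x)) (trans ([m*n+o]%[p*n]≡[m*n]%[p*n]+o t N x<m)
            (cong (_+ x) (sym (m%n*o≡m*o%[n*o] t N m)))))
        x≡ : x ≡ P v t
        x≡ = trans (sym (proj₂ coordinates)) (trans (sym (inc⇒P v e ne))
          (trans (cong (P v) (proj₁ coordinates)) (P-% v t)))

-- Odd divisors, Bézout coefficients and the final case split

double≢odd : ∀ k h → k + k ≢ suc (h + h)
double≢odd k h eq with () ← trans (sym (even-double k)) (trans (cong even eq) (cong not (even-double h)))

-- Makes `g` and `L` odd, as halving in ℤ/g and ℤ/L requires.
odd-divisor : ∀ {d h} → d ∣ suc (h + h) → ∃[ k ] d ≡ suc (k + k)
odd-divisor {d} {h} (divides c eq) with even-split d
... | inj₂ odd        = odd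
... | inj₁ (k , refl) = contradiction (sym (trans eq (*-distribˡ-+ c k k))) (double≢odd (c * k) h)

negative-inverse : ∀ {g r′ l} .{{_ : NonZero g}} → Bézout.Identity.Identity g (r′ * g) (suc l * g) →
  ∃[ u ] ∃[ c ] 1 + r′ * u ≡ c * suc l
negative-inverse {g} {r′} {l} (Bézout.Identity.-+ x y eq) =
  x , y , *-cancelʳ-≡ _ _ g (trans (l₁ r′ x g) (trans eq (l₂ y l g)))
  where
  l₁ : ∀ r x g → (1 + r * x) * g ≡ g + x * (r * g)
  l₁ = solve-∀
  l₂ : ∀ y l g → y * (suc l * g) ≡ y * suc l * g
  l₂ = solve-∀
-- Here `x` inverts `r′` modulo `suc l`, and multiplying by `l` ≡ -1 changes its sign.
negative-inverse {g} {r′} {l} (Bézout.Identity.+- x y eq) =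
  x * l , 1 + y * l , trans (l₃ r′ x l) (trans (cong (λ a → 1 + a * l) (sym inverse)) (l₄ y l))
  where
  l₁ : ∀ y l g → (1 + y * suc l) * g ≡ g + y * (suc l * g)
  l₁ = solve-∀
  l₂ : ∀ x r g → x * (r * g) ≡ x * r * g
  l₂ = solve-∀
  inverse : 1 + y * suc l ≡ x * r′
  inverse = *-cancelʳ-≡ _ _ g (trans (l₁ y l g) (trans eq (l₂ x r′ g)))
  l₃ : ∀ r x l → 1 + r * (x * l) ≡ 1 + x * r * l
  l₃ = solve-∀
  l₄ : ∀ y l → 1 + (1 + y * suc l) * l ≡ (1 + y * l) * suc l
  l₄ = solve-∀

theorem-even : ∀ h r → 3 ≤ 2+ (h + h) → 1 ≤ r → r ≤ h + h →
  IsCmsComplete (2+ (h + h)) r ((r * 2+ (h + h) ∸ 1) / 2)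
theorem-even h r 3≤n 1≤r r≤ = go (gcd r N) (gcd[m,n]∣m r N) (gcd[m,n]∣n r N) (Bézout.identity (gcd-GCD r N))
  where
  N = suc (h + h)
  go : ∀ g → g ∣ r → g ∣ N → Bézout.Identity.Identity g r N →
    IsCmsComplete (suc N) r ((r * suc N ∸ 1) / 2)
  go g (divides r′ r≡) g∣N@(divides L N≡) identity
    with g′ , refl ← odd-divisor {h = h} g∣N
    with L′ , refl ← odd-divisor {h = h} (divides g (trans N≡ (*-comm L g)))
    with u , c , bezout ← negative-inverse {suc (g′ + g′)} {r′} {L′ + L′} (subst₂ (Bézout.Identity.Identity (suc (g′ + g′))) r≡ N≡ identity) =
    subst₂ (λ r N → IsCmsComplete (suc N) r ((r * suc N ∸ 1) / 2)) (sym r≡) (sym N≡)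
      (EvenOrder.cms-even g′ L′ r′ u c bezout 1≤r′ (subst (λ N → 3 ≤ suc N) N≡ 3≤n)
        (subst₂ (λ r N → r ≤ suc N ∸ 2) r≡ N≡ r≤))
    where
    1≤r′ : 1 ≤ r′
    1≤r′ = n≢0⇒n>0 λ { refl → contradiction r≡ (m<n⇒n≢0 1≤r) }

theorem5 : (n r : ℕ) → 3 ≤ n → 1 ≤ r → r ≤ n ∸ 2 →
    (2 ∣ n ⊎ (¬ (2 ∣ n) × r ≡ (n ∸ 1) / 2)) →
    IsCmsComplete n r ((r * n ∸ 1) / 2)
theorem5 n r 3≤n 1≤r r≤ cases with even-split n | cases
... | inj₁ (suc h , refl) | _ rewrite +-suc h h = theorem-even h r 3≤n 1≤r r≤
... | inj₂ (h , refl) | inj₁ (divides c eq) = contradiction (sym (trans eq (*-distribˡ-+ c 1 1)))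
  (subst (λ d → d + d ≢ suc (h + h)) (sym (*-identityʳ c)) (double≢odd c h))
... | inj₂ (h , refl) | inj₂ (_ , r≡) with refl ← trans r≡ (halve-double h) = theorem-odd h 3≤n r≤
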